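{- Let $\Phi$ be a polynomial-time computable implicit set system and let $\mathbb{D}$ be a consistently diverse diversity function. There is an algorithm for the problem $(\mathbb{D},\Phi)$-Diverse that, on an input $(I,k_1,\ldots,k_r,b)$ with $k:=\max_{i\in[r]}k_i$, makes at most $(2kr)^{kr}\cdot r$ oracle calls to the problem $\Phi$-Forbidden Subset. Moreover, in every oracle call, the parameter satisfies $s+|\mathsf{Forb}|\le k+2kr$. Consequently, if $\Phi$-Forbidden Subset admits a fixed-parameter tractable algorithm parameterized by $s+|\mathsf{Forb}|$, then $(\mathbb{D},\Phi)$-Diverse is fixed-parameter tractable parameterized by $k+r$.
   Context: Notation: $[r]=\{1,\ldots,r\}$; $\uplus$ denotes disjoint union. Implicit set system: a function $\Phi$ that maps each binary string $I\in\{0,1\}^*$ (an instance) to a set system $(U_I,\mathcal{F}_I)$, where $U_I$ is a universe and $\mathcal{F}_I\subseteq 2^{U_I}$ is a family of subsets of $U_I$ (the feasible solutions). $\Phi$ is polynomial-time computable if (i) there is a polynomial-time algorithm that, given $I$, outputs $U_I$, and (ii) there is a polynomial-time algorithm that, given $I$, $U_I$ and $S\subseteq U_I$, decides whether $S\in\mathcal{F}_I$. Diversity function: a map $\mathbb{D}:(2^{U})^r\to\mathbb{Z}_{\ge 0}$ assigning a non-negative integer to every $r$-tuple of subsets of a universe $U$ (here $U=U_I$). Relation $\le_{\mathcal D}$: for two $r$-tuples $\mathbb{T}_1=(A_1,\ldots,A_r)$ and $\mathbb{T}_2=(J_1,\ldots,J_r)$ of sets, write $\mathbb{T}_1\le_{\mathcal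 D}\mathbb{T}_2$ if there exist decompositions $A_i=B_i\uplus C_i$ and $J_i=K_i\uplus L_i$ for each $i\in[r]$ such that: (1) for every $i\in[r]$, $K_i\subseteq B_i$ and $|A_i|=|J_i|$; (2) for all distinct $i,j\in[r]$, $L_i\cap L_j=\emptyset$; (3) for every $i\in[r]$, $L_i\cap B_j=\emptyset$ for all $j\in[r]$. Consistently diverse: $\mathbb{D}$ is consistently diverse if for any two $r$-tuples $\mathbb{T}_1,\mathbb{T}_2$ of subsets of a common universe $U$, whenever $\mathbb{T}_1\le_{\mathcal D}\mathbb{T}_2$ we have $\mathbb{D}(\mathbb{T}_1)\le\mathbb{D}(\mathbb{T}_2)$. Problem $(\mathbb{D},\Phi)$-Diverse. Input: an instance $I$, integers $k_1,\ldots,k_r\in\mathbb{N}$, and a positive integer $b$; $k:=\max_{i\in[r]}k_i$. Parameter: $k+r$. Question: does there exist an $r$-tuple $(X_1,\ldots,X_r)\in\mathcal{F}_I^{\,r}$ such that $|X_i|=k_i$ for all $i\in[r]$ and $\mathbb{D}(X_1,\ldots,X_r)\ge b$? Problem $\Phi$-Forbidden Subset. Input: an instance $I$, an integer $s\in\mathbb{N}$, and a forbidden set $\mathsf{Forb}\subseteq U_I$. Parameter: $s+|\mathsf{Forb}|$. Question: does there exist a set $S\in\mathcal{F}_I$ such that $|S|=s$ and $S\cap\mathsf{Forb}=\emptyset$? If yes, output such a set $S$ (otherwise report that none exists). Fixed-parameter tractable with parameter $p$: solvable in time $f(p)\cdot|I|^{O(1)}$ for some computable function $f$, where $I$ is the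 input instance.
   Formalization: The English puts no computability condition on the diversity function, which makes it false for uncomputable ones; here the oracle algorithm may also query whether D(X) ≥ b, and the fixed-parameter consequence assumes that this test is decidable in polynomial time. -}

module Defs where

open import Data.Bool.Base using (Bool; true; false)
open import Data.Empty using (⊥)
open import Data.Fin.Base using (Fin)
open import Data.Fin.Subset using (Subset; _⊆_; _∩_; _∪_; ∣_∣; Empty)
open import Data.List.Base using (List; []; _∷_; _++_; length)
open import Data.List.Relation.Unary.All using (All)
open import Data.Nat.Base using (ℕ; zero; suc; _+_; _*_; _^_; _⊔_; _≤_; _<_)
open import Data.Nat.Binary.Base using (ℕᵇ; 2[1+_]; 1+[2_]; fromℕ)
open import Data.Product.Base using (Σ; ∃; ∃-syntax; Σ-syntax; _×_; _,_)
open import Data.Sum.Base using (_⊎_)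
open import Data.Vec.Base using (Vec; []; _∷_; lookup; toList; foldr′)
open import Data.Vec.Relation.Unary.Unique.Propositional using (Unique)
open import Relation.Binary.PropositionalEquality using (_≡_; _≢_)
open import Relation.Nullary.Negation using (¬_)

------------------------------------------------------------------------
-- A machine model
--
-- Programs form a first-order, call-by-value functional language with
-- general recursion over binary trees (LISP data).  Every evaluation
-- rule has positive cost, and reading a variable or receiving an answer
-- costs the size of the value obtained.  So the size of a result never
-- exceeds the cost of computing it, values cannot grow exponentially
-- through sharing, and the cost agrees with Turing machine time up to a
-- polynomial.

data Data : Set where
  nil  : Data
  cons : Data → Data → Data

size : Data → ℕ
size nil        = 1
size (cons a b) = suc (size a + size b)

-- Ω names the available oracles, m is the arity of the enclosing
-- function (the one `self` calls), n is the number of variables in scope.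
-- A called function is closed: its body sees only its own arguments.
data Term (Ω : Set) (m : ℕ) : ℕ → Set
data Function (Ω : Set) : ℕ → Set

data Term Ω m where
  var  : ∀ {n} → Fin n → Term Ω m n
  nil  : ∀ {n} → Term Ω m n
  cons : ∀ {n} → Term Ω m n → Term Ω m n → Term Ω m n
  case : ∀ {n} → Term Ω m n → Term Ω m n → Term Ω m (2 + n) → Term Ω m n
  call : ∀ {n l} → Function Ω l → Vec (Term Ω m n) l → Term Ω m n
  self : ∀ {n} → Vec (Term Ω m n) m → Term Ω m n
  ask  : ∀ {n} → Ω → Term Ω m n → Term Ω m n

data Function Ω where
  fun : ∀ {m} → Term Ω m m → Function Ω m

Program : Set → Set
Program Ω = Function Ω 1

Trace : Set → Set
Trace Ω = List (Ω × Data)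

module _ {Ω : Set} (O : Ω → Data → Data) where

  -- Eval body ρ e d t q: inside the function with the given body and in
  -- environment ρ, the term e evaluates to d at cost t, asking the oracle
  -- queries q.
  data Eval {m} (body : Term Ω m m) {n} (ρ : Vec Data n) :
            Term Ω m n → Data → ℕ → Trace Ω → Set
  data Evals {m} (body : Term Ω m m) {n} (ρ : Vec Data n) :
             ∀ {l} → Vec (Term Ω m n) l → Vec Data l → ℕ → Trace Ω → Set

  data Eval {m} body {n} ρ where
    var : ∀ i → Eval body ρ (var i) (lookup ρ i) (size (lookup ρ i)) []

    nil : Eval body ρ nil nil 1 []

    cons : ∀ {e₁ e₂ d₁ d₂ t₁ t₂ q₁ q₂} →
           Eval body ρ e₁ d₁ t₁ q₁ → Eval body ρ e₂ d₂ t₂ q₂ →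
           Eval body ρ (cons e₁ e₂) (cons d₁ d₂) (suc (t₁ + t₂)) (q₁ ++ q₂)

    case-nil : ∀ {e e₁ e₂ d t₁ t₂ q₁ q₂} →
               Eval body ρ e nil t₁ q₁ → Eval body ρ e₁ d t₂ q₂ →
               Eval body ρ (case e e₁ e₂) d (suc (t₁ + t₂)) (q₁ ++ q₂)

    case-cons : ∀ {e e₁ e₂ a b d t₁ t₂ q₁ q₂} →
                Eval body ρ e (cons a b) t₁ q₁ →
                Eval body (a ∷ b ∷ ρ) e₂ d t₂ q₂ →
                Eval body ρ (case e e₁ e₂) d (suc (t₁ + t₂)) (q₁ ++ q₂)

    call : ∀ {l} {body′ : Term Ω l l} {es ds d t₁ t₂ q₁ q₂} →
           Evals body ρ es ds t₁ q₁ → Eval body′ ds body′ d t₂ q₂ →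
           Eval body ρ (call (fun body′) es) d (suc (t₁ + t₂)) (q₁ ++ q₂)

    self : ∀ {es ds d t₁ t₂ q₁ q₂} →
           Evals body ρ es ds t₁ q₁ → Eval body ds body d t₂ q₂ →
           Eval body ρ (self es) d (suc (t₁ + t₂)) (q₁ ++ q₂)

    ask : ∀ {ω e d t q} → Eval body ρ e d t q →
          Eval body ρ (ask ω e) (O ω d) (suc (t + size (O ω d)))
               (q ++ (ω , d) ∷ [])

  data Evals {m} body {n} ρ where
    []  : Evals body ρ [] [] 0 []
    _∷_ : ∀ {l e d t₁ t₂ q₁ q₂} {es : Vec (Term Ω m n) l} {ds} →
          Eval body ρ e d t₁ q₁ → Evals body ρ es ds t₂ q₂ →
          Evals body ρ (e ∷ es) (d ∷ ds) (t₁ + t₂) (q₁ ++ q₂)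

  Run : Program Ω → Data → Data → ℕ → Trace Ω → Set
  Run (fun body) x = Eval body (x ∷ []) body

RunPlain : Program ⊥ → Data → Data → ℕ → Set
RunPlain p x y t = ∃[ q ] Run (λ ()) p x y t q

------------------------------------------------------------------------
-- Encodings

codeBool : Bool → Data
codeBool false = nil
codeBool true  = cons nil nil

codeList : ∀ {A : Set} → (A → Data) → List A → Data
codeList c []       = nil
codeList c (x ∷ xs) = cons (c x) (codeList c xs)

codeVec : ∀ {A : Set} {n} → (A → Data) → Vec A n → Data
codeVec c xs = codeList c (toList xs)

codeUnary : ℕ → Data
codeUnary zero    = nil
codeUnary (suc n) = cons nil (codeUnary n)

codeℕᵇ : ℕᵇ → Data
codeℕᵇ ℕᵇ.zero  = nil
codeℕᵇ 2[1+ n ] = cons (codeBool false) (codeℕᵇ n)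
codeℕᵇ 1+[2 n ] = cons (codeBool true) (codeℕᵇ n)

codeBinary : ℕ → Data
codeBinary n = codeℕᵇ (fromℕ n)

-- Characteristic vector, in the order in which the universe is listed.
codeSubset : ∀ {n} → Subset n → Data
codeSubset = codeVec codeBool

------------------------------------------------------------------------
-- Problems and complexity classes

-- Correct x y: y is an acceptable output on input x.
record Problem : Set₁ where
  field
    Input   : Set
    code    : Input → Data
    Correct : Input → Data → Set

open Problem public

Decides : Set → Data → Set
Decides P y = (y ≡ codeBool true × P) ⊎ (y ≡ codeBool false × ¬ P)

Solves : Problem → (Data → Data) → Set
Solves P o = ∀ x → Correct P x (o (code P x))

PolyTime : Problem → Set
PolyTime P =
  ∃[ p ] ∃[ a ] ∃[ c ]
  ∀ (x : Input P) → ∃[ y ] ∃[ t ]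
    RunPlain p (code P x) y t × Correct P x y × t ≤ a * size (code P x) ^ c

Computable : (ℕ → ℕ) → Set
Computable f =
  ∃[ p ] ∀ n → ∃[ t ] RunPlain p (codeUnary n) (codeUnary (f n)) t

FPT : (P : Problem) → (Input P → ℕ) → Set
FPT P κ =
  ∃[ p ] ∃[ f ] ∃[ c ] Computable f ×
  (∀ (x : Input P) → ∃[ y ] ∃[ t ]
    RunPlain p (code P x) y t × Correct P x y ×
    t ≤ f (κ x) * size (code P x) ^ c)

------------------------------------------------------------------------
-- Implicit set systems

-- A finite set, its elements being named by distinct data values.
-- Subsets are sets of positions in `elements`.
record Universe : Set where
  field
    card      : ℕ
    elements  : Vec Data card
    .distinct : Unique elements

open Universe public

codeUniverse : Universe → Data
codeUniverse U = codeVec (λ d → d) (elements U)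

record SetSystem : Set₁ where
  field
    universe : Universe
    Feasible : Subset (card universe) → Set

open SetSystem public

Instance : Set
Instance = List Bool

codeInstance : Instance → Data
codeInstance = codeList codeBool

ImplicitSetSystem : Set₁
ImplicitSetSystem = Instance → SetSystem

∣U∣ : ImplicitSetSystem → Instance → ℕ
∣U∣ Φ I = card (universe (Φ I))

UniverseProblem : ImplicitSetSystem → Problem
UniverseProblem Φ = record
  { Input   = Instance
  ; code    = codeInstance
  ; Correct = λ I y → y ≡ codeUniverse (universe (Φ I))
  }

MembershipProblem : ImplicitSetSystem → Problem
MembershipProblem Φ = record
  { Input   = Σ[ I ∈ Instance ] Subset (∣U∣ Φ I)
  ; code    = λ { (I , S) →
                  cons (codeInstance I)
                       (cons (codeUniverse (universe (Φ I))) (codeSubset S)) }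
  ; Correct = λ { (I , S) → Decides (Feasible (Φ I) S) }
  }

PolyTimeComputable : ImplicitSetSystem → Set
PolyTimeComputable Φ =
  PolyTime (UniverseProblem Φ) × PolyTime (MembershipProblem Φ)

------------------------------------------------------------------------
-- Diversity functions

DiversityFunction : Set
DiversityFunction = (U : Universe) {r : ℕ} → Vec (Subset (card U)) r → ℕ

infix 4 _≐_⊎_ _≤𝒟_

_≐_⊎_ : ∀ {n} → Subset n → Subset n → Subset n → Set
A ≐ B ⊎ C = A ≡ B ∪ C × Empty (B ∩ C)

record _≤𝒟_ {n r} (A J : Vec (Subset n) r) : Set where
  field
    B C K L    : Fin r → Subset n
    A≐B⊎C      : ∀ i → lookup A i ≐ B i ⊎ C i
    J≐K⊎L      : ∀ i → lookup J i ≐ K i ⊎ L i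
    K⊆B        : ∀ i → K i ⊆ B i
    ∣A∣≡∣J∣    : ∀ i → ∣ lookup A i ∣ ≡ ∣ lookup J i ∣
    L∩L-empty  : ∀ i j → i ≢ j → Empty (L i ∩ L j)
    L∩B-empty  : ∀ i j → Empty (L i ∩ B j)

ConsistentlyDiverse : DiversityFunction → Set
ConsistentlyDiverse 𝔻 =
  ∀ (U : Universe) {r} (T₁ T₂ : Vec (Subset (card U)) r) →
  T₁ ≤𝒟 T₂ → 𝔻 U T₁ ≤ 𝔻 U T₂

record ThresholdInput : Set where
  field
    U : Universe
    r : ℕ
    X : Vec (Subset (card U)) r
    b : ℕ

-- Access to 𝔻 is through the comparison 𝔻(X₁,…,Xᵣ) ≥ b, with b in binary.
-- This follows from evaluating 𝔻, but does not charge for reading its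
-- value, whose length is not bounded in terms of the tuple.
ThresholdProblem : DiversityFunction → Problem
ThresholdProblem 𝔻 = record
  { Input   = ThresholdInput
  ; code    = λ x → let open ThresholdInput x in
                cons (codeUniverse U)
                     (cons (codeVec codeSubset X) (codeBinary b))
  ; Correct = λ x → let open ThresholdInput x in Decides (b ≤ 𝔻 U X)
  }

------------------------------------------------------------------------
-- Φ-Forbidden Subset

record ForbiddenInput (Φ : ImplicitSetSystem) : Set where
  field
    I    : Instance
    s    : ℕ
    Forb : Subset (∣U∣ Φ I)

  Solution : Subset (∣U∣ Φ I) → Set
  Solution S = Feasible (Φ I) S × ∣ S ∣ ≡ s × Empty (S ∩ Forb)

-- Numbers bounded by the parameter are written in unary, which changes
-- the input length only by a function of the parameter.
ForbiddenSubset : ImplicitSetSystem → Problem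
ForbiddenSubset Φ = record
  { Input   = ForbiddenInput Φ
  ; code    = λ x → let open ForbiddenInput x in
                cons (codeInstance I) (cons (codeUnary s) (codeSubset Forb))
  ; Correct = λ x y → let open ForbiddenInput x in
                (∃[ S ] y ≡ cons nil (codeSubset S) × Solution S)
                ⊎ (y ≡ nil × ¬ ∃ Solution)
  }

forbiddenParam : ∀ {Φ} → ForbiddenInput Φ → ℕ
forbiddenParam x = let open ForbiddenInput x in s + ∣ Forb ∣

------------------------------------------------------------------------
-- (𝔻,Φ)-Diverse

record DiverseInput : Set where
  field
    I   : Instance
    r   : ℕ
    ks  : Vec ℕ r
    b   : ℕ
    b>0 : 0 < b

  k : ℕ
  k = foldr′ _⊔_ 0 ks

DiverseSolution : (𝔻 : DiversityFunction) (Φ : ImplicitSetSystem)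
                  (x : DiverseInput) → let open DiverseInput x in
                  Vec (Subset (∣U∣ Φ I)) r → Set
DiverseSolution 𝔻 Φ x X = let open DiverseInput x in
  (∀ i → Feasible (Φ I) (lookup X i)) ×
  (∀ i → ∣ lookup X i ∣ ≡ lookup ks i) ×
  b ≤ 𝔻 (universe (Φ I)) X

Diverse : DiversityFunction → ImplicitSetSystem → Problem
Diverse 𝔻 Φ = record
  { Input   = DiverseInput
  ; code    = λ x → let open DiverseInput x in
                cons (codeInstance I)
                     (cons (codeVec codeUnary ks) (codeBinary b))
  ; Correct = λ x → Decides (∃ (DiverseSolution 𝔻 Φ x))
  }

diverseParam : DiverseInput → ℕ
diverseParam x = let open DiverseInput x in k + r

------------------------------------------------------------------------
-- Oracle algorithms for (𝔻,Φ)-Diverse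

data Oracle : Set where
  forbidden threshold : Oracle

oracleProblem : DiversityFunction → ImplicitSetSystem → Oracle → Problem
oracleProblem 𝔻 Φ forbidden = ForbiddenSubset Φ
oracleProblem 𝔻 Φ threshold = ThresholdProblem 𝔻

forbiddenQueries : Trace Oracle → List Data
forbiddenQueries []                    = []
forbiddenQueries ((forbidden , d) ∷ q) = d ∷ forbiddenQueries q
forbiddenQueries ((threshold , _) ∷ q) = forbiddenQueries q

-- The running time charges an oracle call only for its query and answer.
-- Without a time bound the claim would be trivial: brute force over all
-- tuples of subsets needs no call to Φ-Forbidden Subset.
OracleAlgorithm : DiversityFunction → ImplicitSetSystem → Set
OracleAlgorithm 𝔻 Φ =
  ∃[ p ] ∃[ f ] ∃[ c ] Computable f ×
  (∀ (O : Oracle → Data → Data) →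
   (∀ ω → Solves (oracleProblem 𝔻 Φ ω) (O ω)) →
   ∀ (x : DiverseInput) → let open DiverseInput x in
   ∃[ y ] ∃[ t ] ∃[ q ]
     Run O p (code (Diverse 𝔻 Φ) x) y t q ×
     Correct (Diverse 𝔻 Φ) x y ×
     length (forbiddenQueries q) ≤ (2 * k * r) ^ (k * r) * r ×
     All (λ d → Σ[ z ∈ ForbiddenInput Φ ]
                  d ≡ code (ForbiddenSubset Φ) z ×
                  forbiddenParam z ≤ k + 2 * k * r)
         (forbiddenQueries q) ×
     t ≤ f (diverseParam x) * size (code (Diverse 𝔻 Φ) x) ^ c)

-- The search tree has nodes (B₁, …, Bᵣ), where Bᵢ is a guessed part of the
-- i-th set Aᵢ of a solution.  At a node, let G = ⋃ Bⱼ and, for i = 1, …, r, ask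
-- for a feasible Jᵢ of size kᵢ avoiding G ─ Bᵢ, then add Jᵢ to G.
--
-- If all r calls succeed, then Lᵢ = Jᵢ ─ Bᵢ is disjoint from every Bⱼ and
-- every other Lⱼ, so (J₁, …, Jᵣ) is at least as diverse as any solution
-- extending the node, and one comparison with b decides the node.
-- If call i fails, then Aᵢ meets the forbidden set, and branching over the
-- element added to Bᵢ keeps the guess correct for one of the children.
--
-- With n = Σ kᵢ, the depth is at most n because Σ |Bᵢ| grows by one, and an
-- inner node has at most (n - 1) + n children, so there are at most
-- (1 + (2n - 1))ⁿ nodes with r calls each.

module Submission where

open import Defs
open import Data.Bool.Base using (Bool; true; false; _∨_; if_then_else_)
open import Data.Empty using (⊥)
open import Data.Fin.Base using (Fin; zero; suc)
open import Data.Fin.Patterns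
open import Data.Fin.Subset using (Subset; _∪_; _∩_; _─_; ∣_∣; _⊆_; _∈_; _∉_; Empty) renaming (⊥ to ∅)
open import Data.Fin.Subset.Properties
open import Data.List.Base as List using (List; []; _∷_; _++_; length)
open import Data.List.Properties using (length-map; length-++)
open import Data.List.Relation.Unary.All as Allᴸ using ([]; _∷_) renaming (All to Allᴸ)
import Data.List.Relation.Unary.All.Properties as Allᴸ
open import Data.List.Relation.Unary.Any as Any using (Any; here; there)
import Data.List.Relation.Unary.Any.Properties as Any
open import Data.Nat.Base
open import Data.Nat.Properties
open import Data.Nat.Tactic.RingSolver using (solve-∀)
open import Data.Product.Base using (∃; ∃-syntax; Σ-syntax; _×_; _,_; proj₁; proj₂)
open import Data.Sum.Base using (_⊎_; inj₁; inj₂)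
open import Data.Unit.Base using (⊤; tt)
open import Data.Vec.Base as Vec using (Vec; []; _∷_; lookup; toList; zipWith; here; there)
open import Data.Vec.Properties using (length-toList)
open import Data.Vec.Relation.Unary.All as All using (All; []; _∷_)
open import Data.Vec.Relation.Unary.All.Properties using (lookup⁺)
open import Data.Vec.Relation.Binary.Pointwise.Inductive as Pointwise using (Pointwise; []; _∷_)
open import Function.Base using (_∘_)
open import Relation.Binary.PropositionalEquality
open import Relation.Nullary.Decidable using (yes; no)
open import Relation.Nullary.Negation using (¬_; contradiction)

-- Both claims rest on one program, abstract in the functions that answer forbidden-subset queries,
-- compare with b and list the universe. Oracle calls fill the first two slots for the query bound,
-- lifted solvers fill them for tractability, and the search is analysed only once. The obstacle is
-- time, since reading a value costs its size. All values met by the search are bounded by a single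
-- `M`, polynomial in the input length, and costs are counted in multiples of `M`. What remains of
-- the analysis is polynomial arithmetic. The bound on the universe that `M` needs comes from the
-- running time of the program that lists it. The search runs over a list of sibling states with
-- unary fuel. Fuel plus Σ |Bᵢ| is always Σ kᵢ, so the fuel is spent exactly when no child could
-- still fit inside a solution. Since G also receives the sets Jᵢ already found, a single forbidden
-- set enforces both disjointness conditions on the later Lⱼ.

private
  variable
    Ω : Set

-- Reduces a polynomial inequality to an identity for the ring solver, the difference `o` being
-- supplied by hand.
≤-slack : ∀ {m n} o → m + o ≡ n → m ≤ n
≤-slack {m} o refl = m≤m+n m o

-- Keeps the cost analysis independent of what is counted. The oracle version counts
-- forbidden-subset queries and checks their parameters; the tractability version counts nothing.
record Metering (Ω : Set) : Set₁ where
  field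
    Asks    : ℕ → Trace Ω → Set
    asks-[] : Asks 0 []
    asks-++ : ∀ {i j p q} → Asks i p → Asks j q → Asks (i + j) (p ++ q)
    asks-≤  : ∀ {i j q} → i ≤ j → Asks i q → Asks j q

-- The program, with variables as de Bruijn indices

v0 : ∀ {m n} → Term Ω m (1 + n)
v0 = var 0F

v1 : ∀ {m n} → Term Ω m (2 + n)
v1 = var 1F

v2 : ∀ {m n} → Term Ω m (3 + n)
v2 = var 2F

v3 : ∀ {m n} → Term Ω m (4 + n)
v3 = var 3F

v4 : ∀ {m n} → Term Ω m (5 + n)
v4 = var 4F

v5 : ∀ {m n} → Term Ω m (6 + n)
v5 = var 5F

v6 : ∀ {m n} → Term Ω m (7 + n)
v6 = var 6F

v7 : ∀ {m n} → Term Ω m (8 + n)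
v7 = var 7F

v8 : ∀ {m n} → Term Ω m (9 + n)
v8 = var 8F

v9 : ∀ {m n} → Term Ω m (10 + n)
v9 = var 9F

v10 : ∀ {m n} → Term Ω m (11 + n)
v10 = var (suc 9F)

trueᵗ : ∀ {m n} → Term Ω m n
trueᵗ = cons nil nil

addFun : Function Ω 2
addFun = fun (case v0 v1 (cons nil (self (v1 ∷ v3 ∷ []))))

sumFun : Function Ω 1
sumFun = fun (case v0 nil (call addFun (v0 ∷ self (v1 ∷ []) ∷ [])))

-- The term e of zipFun sees the two heads as v2 and v0.
zipFun : Term Ω 2 6 → Function Ω 2
zipFun e = fun (case v0 nil (case v3 nil (cons e (self (v3 ∷ v1 ∷ [])))))

unionFun : Function Ω 2
unionFun = zipFun (case v2 v0 trueᵗ)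

diffFun : Function Ω 2
diffFun = zipFun (case v0 v2 nil)

-- The term e of mapFun sees the head as v0 and the two parameters as v2 and v3.
mapFun : Term Ω 3 5 → Function Ω 3
mapFun e = fun (case v2 nil (cons e (self (v2 ∷ v3 ∷ v1 ∷ []))))

emptiesFun : Function Ω 3
emptiesFun = mapFun nil

rootFun : Function Ω 3
rootFun = mapFun (cons v0 v2)

prependFun : Function Ω 3
prependFun = mapFun (cons v2 v0)

wrapFun : Function Ω 3
wrapFun = mapFun (cons (cons v2 v0) v3)

extendFun : Function Ω 2
extendFun = fun (case v0 nil (case v3 nil (case v0
  (call prependFun (v2 ∷ nil ∷ self (v3 ∷ v1 ∷ []) ∷ []))
  (cons (cons trueᵗ v5) (call prependFun (v4 ∷ nil ∷ self (v5 ∷ v3 ∷ []) ∷ []))))))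

-- The first argument is the code of ∅: an empty state does not reveal the size of the universe.
unionsFun : Function Ω 2
unionsFun = fun (case v1 v0 (case v0 nil (call unionFun (v1 ∷ self (v4 ∷ v3 ∷ []) ∷ []))))

module Algorithm (forb thr univ : Function Ω 1) where

  -- Arguments: I, G, state.  The result is tagged with true for a full tuple
  -- J₁, …, Jᵣ and with false for a list of child states.
  sweepFun : Function Ω 3
  sweepFun = fun (case v2 (cons trueᵗ nil) (case v0 nil
    (case (call forb (cons v4 (cons v0 (call diffFun (v5 ∷ v1 ∷ []))) ∷ []))
      -- The call failed: one child for every element of G ─ B, added to the head set.
      (cons nil (call wrapFun (v0 ∷ v3 ∷ call extendFun (v1 ∷ call diffFun (v5 ∷ v1 ∷ []) ∷ []) ∷ [])))
      (case (self (v6 ∷ call unionFun (v7 ∷ v1 ∷ []) ∷ v5 ∷ [])) nil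
        (case v0
          -- A later call failed: its children get the unchanged head back. In the other branch the
          -- set found is put in front of the later ones.
          (cons nil (call prependFun (v6 ∷ nil ∷ v1 ∷ [])))
          (cons trueᵗ (cons v5 v3)))))))

  -- Arguments: I, U, b, ∅, fuel, states.
  searchFun : Function Ω 6
  searchFun = fun (case v5 nil
    (case (call sweepFun (v2 ∷ call unionsFun (v5 ∷ v0 ∷ []) ∷ v0 ∷ [])) nil
      (case v0
        (case v8
          -- Fuel spent: the state is dropped and the siblings are searched. All states of the list
          -- have the same remaining depth, so they share the fuel.
          (self (v4 ∷ v5 ∷ v6 ∷ v7 ∷ v8 ∷ v3 ∷ []))
          (case (self (v6 ∷ v7 ∷ v8 ∷ v9 ∷ v1 ∷ v3 ∷ []))
            (self (v6 ∷ v7 ∷ v8 ∷ v9 ∷ v10 ∷ v5 ∷ []))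
            trueᵗ))
        (case (call thr (cons v7 (cons v3 v8) ∷ []))
          (self (v6 ∷ v7 ∷ v8 ∷ v9 ∷ v10 ∷ v5 ∷ []))
          trueᵗ))))

  -- Arguments: I, ks, b, U, ∅.
  startFun : Function Ω 5
  startFun = fun (call searchFun (v0 ∷ v3 ∷ v2 ∷ v4 ∷ call sumFun (v1 ∷ []) ∷
    cons (call rootFun (v4 ∷ nil ∷ v1 ∷ [])) nil ∷ []))

  setupFun : Function Ω 4
  setupFun = fun (call startFun (v0 ∷ v1 ∷ v2 ∷ v3 ∷ call emptiesFun (nil ∷ nil ∷ v3 ∷ []) ∷ []))

  diverseFun : Program Ω
  diverseFun = fun (case v0 nil (case v1 nil
    (call setupFun (v2 ∷ v0 ∷ v1 ∷ call univ (v2 ∷ []) ∷ []))))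

-- Cost calculus

module Calculus {Ω : Set} (O : Ω → Data → Data) (metering : Metering Ω)
                (M : ℕ) (M>0 : 1 ≤ M) where
  open Metering metering

  Small : Data → Set
  Small d = size d ≤ M

  small-nil : Small nil
  small-nil = M>0

  small-head : ∀ {a b} → Small (cons a b) → Small a
  small-head {a} {b} s = ≤-trans (m≤m+n (size a) (size b)) (<⇒≤ s)

  small-tail : ∀ {a b} → Small (cons a b) → Small b
  small-tail {a} {b} s = ≤-trans (m≤n+m (size b) (size a)) (<⇒≤ s)

  -- Costs are counted in multiples of M, a common bound on the sizes of all
  -- data in the environment, so that reading a variable has cost 1.
  record Cost {m} (body : Term Ω m m) {n} (ρ : Vec Data n)
              (e : Term Ω m n) (d : Data) (c j : ℕ) : Set where
    constructor mk
    field
      run : All Small ρ →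
            ∃[ t ] ∃[ q ] Eval O body ρ e d t q × t ≤ c * M × Asks j q
  open Cost public

  -- Smallness of the values is part of the result because they become the environment of the called
  -- body, whose cost is known for small environments only.
  record Costs {m} (body : Term Ω m m) {n} (ρ : Vec Data n)
               {l} (es : Vec (Term Ω m n) l) (ds : Vec Data l) (c j : ℕ) : Set where
    constructor mk
    field
      runs : All Small ρ → All Small ds ×
             (∃[ t ] ∃[ q ] Evals O body ρ es ds t q × t ≤ c * M × Asks j q)
  open Costs public

  CallCost : ∀ {l} → Function Ω l → Vec Data l → Data → ℕ → ℕ → Set
  CallCost (fun body) ds = Cost body ds body

  private
    variable
      m n l : ℕ
      body : Term Ω m m
      ρ : Vec Data n
      e e₁ e₂ : Term Ω m n
      es : Vec (Term Ω m n) l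
      ds : Vec Data l
      d d₁ d₂ a b : Data
      c c₁ c₂ j j₁ j₂ : ℕ

  bound-+ : ∀ {s t} c₁ c₂ → s ≤ c₁ * M → t ≤ c₂ * M → s + t ≤ (c₁ + c₂) * M
  bound-+ c₁ c₂ p q = ≤-trans (+-mono-≤ p q) (≤-reflexive (sym (*-distribʳ-+ M c₁ c₂)))

  bound-node : ∀ {s t} c₁ c₂ → s ≤ c₁ * M → t ≤ c₂ * M → suc (s + t) ≤ (1 + (c₁ + c₂)) * M
  bound-node c₁ c₂ p q = +-mono-≤ M>0 (bound-+ c₁ c₂ p q)

  given : (All Small ρ → Cost body ρ e d c j) → Cost body ρ e d c j
  given f .run ρs = f ρs .run ρs

  relax : c ≤ c₁ → j ≤ j₁ → Cost body ρ e d c j → Cost body ρ e d c₁ j₁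
  relax p q x .run ρs with x .run ρs
  ... | t , _ , ev , t≤ , ok = t , _ , ev , ≤-trans t≤ (*-monoˡ-≤ M p) , asks-≤ q ok

  var≡ : ∀ {i} → lookup ρ i ≡ d → Cost body ρ (var i) d 1 0
  var≡ {i = i} refl .run ρs =
    _ , _ , var i , subst (_ ≤_) (sym (+-identityʳ M)) (lookup⁺ ρs i) , asks-[]

  var↓ : ∀ i → Cost body ρ (var i) (lookup ρ i) 1 0
  var↓ i = var≡ refl

  nil↓ : Cost body ρ nil nil 1 0
  nil↓ .run ρs = _ , _ , nil , subst (1 ≤_) (sym (+-identityʳ M)) M>0 , asks-[]

  cons↓ : Cost body ρ e₁ d₁ c₁ j₁ → Cost body ρ e₂ d₂ c₂ j₂ →
          Cost body ρ (cons e₁ e₂) (cons d₁ d₂) (1 + (c₁ + c₂)) (j₁ + j₂)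
  cons↓ {c₁ = c₁} {c₂ = c₂} x y .run ρs with x .run ρs | y .run ρs
  ... | _ , _ , p , s , f | _ , _ , q , t , g = _ , _ , cons p q , bound-node c₁ c₂ s t , asks-++ f g

  case-nil↓ : Cost body ρ e nil c₁ j₁ → Cost body ρ e₁ d c₂ j₂ →
              Cost body ρ (case e e₁ e₂) d (1 + (c₁ + c₂)) (j₁ + j₂)
  case-nil↓ {c₁ = c₁} {c₂ = c₂} x y .run ρs with x .run ρs | y .run ρs
  ... | _ , _ , p , s , f | _ , _ , q , t , g = _ , _ , case-nil p q , bound-node c₁ c₂ s t , asks-++ f g

  case-cons↓ : Small (cons a b) → Cost body ρ e (cons a b) c₁ j₁ → Cost body (a ∷ b ∷ ρ) e₂ d c₂ j₂ →
               Cost body ρ (case e e₁ e₂) d (1 + (c₁ + c₂)) (j₁ + j₂)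
  case-cons↓ {c₁ = c₁} {c₂ = c₂} sm x y .run ρs with x .run ρs | y .run (small-head sm ∷ small-tail sm ∷ ρs)
  ... | _ , _ , p , s , f | _ , _ , q , t , g = _ , _ , case-cons p q , bound-node c₁ c₂ s t , asks-++ f g

  match-nil↓ : ∀ {i} → lookup ρ i ≡ nil → Cost body ρ e₁ d c j →
               Cost body ρ (case (var i) e₁ e₂) d (2 + c) j
  match-nil↓ eq x = case-nil↓ (var≡ eq) x

  -- The value of a variable is small because the environment is. Only a `case` on a computed value
  -- needs a separate size bound.
  match-cons↓ : ∀ {i} → lookup ρ i ≡ cons a b → Cost body (a ∷ b ∷ ρ) e₂ d c j →
                Cost body ρ (case (var i) e₁ e₂) d (2 + c) j
  match-cons↓ {i = i} eq x = given λ ρs → case-cons↓ (subst Small eq (lookup⁺ ρs i)) (var≡ eq) x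

  call↓ : ∀ {f : Function Ω l} → Costs body ρ es ds c₁ j₁ → CallCost f ds d c₂ j₂ →
          Cost body ρ (call f es) d (1 + (c₁ + c₂)) (j₁ + j₂)
  call↓ {c₁ = c₁} {c₂ = c₂} {f = fun _} x y .run ρs with x .runs ρs
  ... | sm , _ , _ , p , s , f with y .run sm
  ... | _ , _ , q , t , g = _ , _ , call p q , bound-node c₁ c₂ s t , asks-++ f g

  self↓ : {body : Term Ω l l} → Costs body ρ es ds c₁ j₁ → Cost body ds body d c₂ j₂ →
          Cost body ρ (self es) d (1 + (c₁ + c₂)) (j₁ + j₂)
  self↓ {c₁ = c₁} {c₂ = c₂} x y .run ρs with x .runs ρs
  ... | sm , _ , _ , p , s , f with y .run sm
  ... | _ , _ , q , t , g = _ , _ , self p q , bound-node c₁ c₂ s t , asks-++ f g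

  []↓ : Costs body ρ [] [] 0 0
  []↓ .runs ρs = [] , _ , _ , [] , z≤n , asks-[]

  infixr 5 _∷↓_ _⊢_◂_

  _⊢_◂_ : Small d → Cost body ρ e d c₁ j₁ → Costs body ρ es ds c₂ j₂ →
           Costs body ρ (e ∷ es) (d ∷ ds) (c₁ + c₂) (j₁ + j₂)
  _⊢_◂_ {c₁ = c₁} {c₂ = c₂} sm x y .runs ρs with x .run ρs | y .runs ρs
  ... | _ , _ , p , s , f | sms , _ , _ , q , t , g = sm ∷ sms , _ , _ , p ∷ q ,
    bound-+ c₁ c₂ s t , asks-++ f g

  _∷↓_ : ∀ i → Costs body ρ es ds c j → Costs body ρ (var i ∷ es) (lookup ρ i ∷ ds) (1 + c) j
  (i ∷↓ y) .runs ρs = (lookup⁺ ρs i ⊢ var↓ i ◂ y) .runs ρs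

-- Codes and their sizes

-- Each size travels with its guess, so that one descent through a state reads both.
codeState : ∀ {l n} → Vec ℕ l → Vec (Subset n) l → Data
codeState []       []       = nil
codeState (k ∷ ks) (B ∷ Bs) = cons (cons (codeUnary k) (codeSubset B)) (codeState ks Bs)

unions : ∀ {l n} → Vec (Subset n) l → Subset n
unions []       = ∅
unions (B ∷ Bs) = B ∪ unions Bs

-- The sets B ∪ {x}, one for each x in F.
extend : ∀ {n} → Subset n → Subset n → List (Subset n)
extend []      []          = []
extend (b ∷ B) (false ∷ F) = List.map (b ∷_) (extend B F)
extend (b ∷ B) (true ∷ F)  = (true ∷ B) ∷ List.map (b ∷_) (extend B F)

─-zipWith : ∀ {n} (p q : Subset n) → zipWith (λ a b → if b then false else a) p q ≡ p ─ q
─-zipWith []      []          = refl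
─-zipWith (a ∷ p) (true ∷ q)  = cong (false ∷_) (─-zipWith p q)
─-zipWith (a ∷ p) (false ∷ q) = cong (a ∷_) (─-zipWith p q)

length-extend : ∀ {n} (B F : Subset n) → length (extend B F) ≡ ∣ F ∣
length-extend []      []          = refl
length-extend (b ∷ B) (false ∷ F) = trans (length-map (b ∷_) (extend B F)) (length-extend B F)
length-extend (b ∷ B) (true ∷ F)  = cong suc (trans (length-map (b ∷_) (extend B F)) (length-extend B F))

size-codeBool : ∀ b → size (codeBool b) ≤ 3
size-codeBool false = s≤s z≤n
size-codeBool true  = ≤-refl

size-codeUnary : ∀ n → size (codeUnary n) ≡ 1 + n * 2
size-codeUnary zero    = refl
size-codeUnary (suc n) = cong (2 +_) (size-codeUnary n)

size-codeList : ∀ {A : Set} (c : A → Data) {s} → (∀ x → size (c x) ≤ s) →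
                ∀ xs → size (codeList c xs) ≤ 1 + length xs * (1 + s)
size-codeList c c≤ []       = ≤-refl
size-codeList c {s} c≤ (x ∷ xs) = begin
  suc (size (c x) + size (codeList c xs)) ≤⟨ s≤s (+-mono-≤ (c≤ x) (size-codeList c c≤ xs)) ⟩
  suc (s + suc (length xs * suc s))       ≡⟨ cong suc (+-suc s _) ⟩
  suc (suc (s + length xs * suc s))       ∎
  where open ≤-Reasoning

size-codeVec : ∀ {A : Set} (c : A → Data) {s} → (∀ x → size (c x) ≤ s) →
               ∀ {n} (xs : Vec A n) → size (codeVec c xs) ≤ 1 + n * (1 + s)
size-codeVec c c≤ []       = ≤-refl
size-codeVec c {s} c≤ {suc n} (x ∷ xs) = begin
  suc (size (c x) + size (codeVec c xs)) ≤⟨ s≤s (+-mono-≤ (c≤ x) (size-codeVec c c≤ xs)) ⟩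
  suc (s + suc (n * suc s))              ≡⟨ cong suc (+-suc s _) ⟩
  suc (suc (s + n * suc s))              ∎
  where open ≤-Reasoning

size-codeSubset : ∀ {n} (S : Subset n) → size (codeSubset S) ≤ 1 + n * 4
size-codeSubset = size-codeVec codeBool size-codeBool

size-codeState : ∀ {l n} (ks : Vec ℕ l) (Bs : Vec (Subset n) l) →
                 size (codeState ks Bs) ≤ size (codeVec codeUnary ks) + l * (2 + n * 4)
size-codeState [] [] = ≤-refl
size-codeState {suc l} {n} (k ∷ ks) (B ∷ Bs) = begin
  2 + (size (codeUnary k) + size (codeSubset B) + size (codeState ks Bs))
    ≤⟨ +-monoʳ-≤ 2 (+-mono-≤ (+-monoʳ-≤ (size (codeUnary k)) (size-codeSubset B)) (size-codeState ks Bs)) ⟩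
  2 + (size (codeUnary k) + (1 + n * 4) + (size (codeVec codeUnary ks) + l * (2 + n * 4)))
    ≡⟨ lemma (size (codeUnary k)) (size (codeVec codeUnary ks)) n l ⟩
  suc (size (codeUnary k) + size (codeVec codeUnary ks)) + suc l * (2 + n * 4) ∎
  where
  open ≤-Reasoning
  lemma : ∀ a b n l → 2 + (a + (1 + n * 4) + (b + l * (2 + n * 4))) ≡ suc (a + b) + suc l * (2 + n * 4)
  lemma = solve-∀

-- The fuel is this sum in unary, and like all values it has to stay below `M`.
sum-size : ∀ {l} (ks : Vec ℕ l) → size (codeUnary (Vec.sum ks)) ≤ size (codeVec codeUnary ks)
sum-size []       = ≤-refl
sum-size (k ∷ ks) = begin
  size (codeUnary (k + Vec.sum ks))        ≡⟨ size-codeUnary (k + Vec.sum ks) ⟩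
  1 + (k + Vec.sum ks) * 2                 ≡⟨ cong suc (*-distribʳ-+ 2 k (Vec.sum ks)) ⟩
  1 + (k * 2 + Vec.sum ks * 2)             ≤⟨ s≤s (+-mono-≤ (n≤1+n (k * 2)) (n≤1+n (Vec.sum ks * 2))) ⟩
  1 + ((1 + k * 2) + (1 + Vec.sum ks * 2))
    ≡⟨ cong₂ (λ a b → 1 + (a + b)) (size-codeUnary k) (size-codeUnary (Vec.sum ks)) ⟨
  1 + (size (codeUnary k) + size (codeUnary (Vec.sum ks)))
    ≤⟨ s≤s (+-monoʳ-≤ (size (codeUnary k)) (sum-size ks)) ⟩
  1 + (size (codeUnary k) + size (codeVec codeUnary ks)) ∎
  where open ≤-Reasoning

length≤size : ∀ {A : Set} (c : A → Data) {l} (xs : Vec A l) → l ≤ size (codeVec c xs)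
length≤size c []       = z≤n
length≤size c (x ∷ xs) = s≤s (≤-trans (length≤size c xs) (m≤n+m _ (size (c x))))

-- Costs of the auxiliary functions

module Library {Ω : Set} (O : Ω → Data → Data) (metering : Metering Ω)
                (M : ℕ) (M>0 : 1 ≤ M) where
  open Calculus O metering M M>0

  add-cost : ∀ m n → CallCost addFun (codeUnary m ∷ codeUnary n ∷ []) (codeUnary (m + n)) (m * 7 + 3) 0
  add-cost zero    n = match-nil↓ refl (var↓ 1F)
  add-cost (suc m) n = match-cons↓ refl (cons↓ nil↓ (self↓ (1F ∷↓ 3F ∷↓ []↓) (add-cost m n)))

  sum-cost : ∀ {l} (ks : Vec ℕ l) → Small (codeVec codeUnary ks) →
             CallCost sumFun (codeVec codeUnary ks ∷ []) (codeUnary (Vec.sum ks))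
               (Vec.sum ks * 7 + l * 9 + 3) 0
  sum-cost [] sm = match-nil↓ refl nil↓
  sum-cost {suc l} (k ∷ ks) sm = relax (≤-reflexive (lemma k (Vec.sum ks) l)) z≤n
    (match-cons↓ refl (call↓ (0F ∷↓ (≤-trans (sum-size ks) (small-tail sm) ⊢
      self↓ (1F ∷↓ []↓) (sum-cost ks (small-tail sm)) ◂ []↓)) (add-cost k (Vec.sum ks))))
    where
    lemma : ∀ k s l → 3 + (1 + (2 + (s * 7 + l * 9 + 3) + 0) + (k * 7 + 3)) ≡ (k + s) * 7 + suc l * 9 + 3
    lemma = solve-∀

  true↓ : ∀ {m n} {body : Term Ω m m} {ρ : Vec Data n} → Cost body ρ trueᵗ (codeBool true) 3 0
  true↓ = cons↓ nil↓ nil↓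

  zip-cost : ∀ {e} (f : Bool → Bool → Bool) →
             (∀ {ρ : Vec Data 6} a b → lookup ρ 2F ≡ codeBool a → lookup ρ 0F ≡ codeBool b →
              ∀ {body} → Cost body ρ e (codeBool (f a b)) 5 0) →
             ∀ {n} (p q : Subset n) →
             CallCost (zipFun e) (codeSubset p ∷ codeSubset q ∷ []) (codeSubset (zipWith f p q))
               (n * 13 + 3) 0
  zip-cost f e↓ []      []      = match-nil↓ refl nil↓
  zip-cost f e↓ (a ∷ p) (b ∷ q) = match-cons↓ refl (match-cons↓ refl
    (cons↓ (e↓ a b refl refl) (self↓ (3F ∷↓ 1F ∷↓ []↓) (zip-cost f e↓ p q))))

  union-cost : ∀ {n} (p q : Subset n) →
               CallCost unionFun (codeSubset p ∷ codeSubset q ∷ []) (codeSubset (p ∪ q)) (n * 13 + 3) 0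
  union-cost = zip-cost _∨_ λ where
    false b refl′ eq → relax (m≤m+n 3 2) z≤n (match-nil↓ refl′ (var≡ eq))
    true  b refl′ eq → match-cons↓ refl′ true↓

  diff-cost : ∀ {n} (p q : Subset n) →
              CallCost diffFun (codeSubset p ∷ codeSubset q ∷ []) (codeSubset (p ─ q)) (n * 13 + 3) 0
  diff-cost {n} p q = subst (λ S → CallCost diffFun (codeSubset p ∷ codeSubset q ∷ [])
                                         (codeSubset S) (n * 13 + 3) 0)
    (─-zipWith p q) (zip-cost (λ a b → if b then false else a) (λ where
      a false eq eq′ → relax (m≤m+n 3 2) z≤n (match-nil↓ eq′ (var≡ eq))
      a true  eq eq′ → relax (m≤m+n 3 2) z≤n (match-cons↓ eq′ nil↓)) p q)

  -- The budget 5 for `e` is what `wrapFun` spends, the most expensive of the instances.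
  map-cost : ∀ {A B : Set} {e x y} (f : A → B) (cA : A → Data) (cB : B → Data) →
             (∀ {s t} a {body} → Cost body (cA a ∷ s ∷ x ∷ y ∷ t ∷ []) e (cB (f a)) 5 0) →
             ∀ as → CallCost (mapFun e) (x ∷ y ∷ codeList cA as ∷ []) (codeList cB (List.map f as))
               (length as * 12 + 3) 0
  map-cost f cA cB e↓ []       = match-nil↓ refl nil↓
  map-cost f cA cB e↓ (a ∷ as) = match-cons↓ refl
    (cons↓ (e↓ a) (self↓ (2F ∷↓ 3F ∷↓ 1F ∷↓ []↓) (map-cost f cA cB e↓ as)))

  prepend-cost : ∀ {A B : Set} {x y} (f : A → B) (cA : A → Data) (cB : B → Data) →
                 (∀ a → cB (f a) ≡ cons x (cA a)) → ∀ as →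
                 CallCost prependFun (x ∷ y ∷ codeList cA as ∷ []) (codeList cB (List.map f as))
                   (length as * 12 + 3) 0
  prepend-cost f cA cB eq = map-cost f cA cB λ a →
    subst (λ d → Cost _ _ _ d 5 0) (sym (eq a)) (relax (m≤m+n 3 2) z≤n (cons↓ (var↓ 2F) (var↓ 0F)))

  wrap-cost : ∀ {A B : Set} {x y} (f : A → B) (cA : A → Data) (cB : B → Data) →
              (∀ a → cB (f a) ≡ cons (cons x (cA a)) y) → ∀ as →
              CallCost wrapFun (x ∷ y ∷ codeList cA as ∷ []) (codeList cB (List.map f as))
                (length as * 12 + 3) 0
  wrap-cost f cA cB eq = map-cost f cA cB λ a →
    subst (λ d → Cost _ _ _ d 5 0) (sym (eq a)) (cons↓ (cons↓ (var↓ 2F) (var↓ 0F)) (var↓ 3F))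

  unions-cost : ∀ {l n} (ks : Vec ℕ l) (Bs : Vec (Subset n) l) → 1 + n * 4 ≤ M →
                CallCost unionsFun (codeSubset {n} ∅ ∷ codeState ks Bs ∷ [])
                  (codeSubset (unions Bs)) (l * (12 + n * 13) + 3) 0
  unions-cost [] [] sm = match-nil↓ refl (var↓ 0F)
  unions-cost {suc l} {n} (k ∷ ks) (B ∷ Bs) sm = relax (≤-reflexive (lemma l n)) z≤n
    (match-cons↓ refl (match-cons↓ refl (call↓
      (1F ∷↓ (≤-trans (size-codeSubset (unions Bs)) sm ⊢
        self↓ (4F ∷↓ 3F ∷↓ []↓) (unions-cost ks Bs sm) ◂ []↓)) (union-cost B (unions Bs)))))
    where
    lemma : ∀ l n → 5 + (1 + (3 + (l * (12 + n * 13) + 3) + 0) + (n * 13 + 3)) ≡ suc l * (12 + n * 13) + 3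
    lemma = solve-∀

  size-extend : ∀ {n} (B F : Subset n) →
                size (codeList codeSubset (extend B F)) ≤ 1 + n * (2 + n * 4)
  size-extend {n} B F = ≤-trans (size-codeList codeSubset size-codeSubset (extend B F))
    (s≤s (*-monoˡ-≤ (2 + n * 4) (≤-trans (≤-reflexive (length-extend B F)) (∣p∣≤n F))))
    where open import Data.Fin.Subset.Properties using (∣p∣≤n)

  -- The fixed `u` bounds the length of every suffix met, so that one size hypothesis and one price
  -- per position serve the whole recursion. The cost is quadratic since each position maps over the
  -- list obtained from the rest.
  extend-cost : ∀ u → 1 + u * (2 + u * 4) ≤ M → ∀ {n} → n ≤ u → (B F : Subset n) →
                CallCost extendFun (codeSubset B ∷ codeSubset F ∷ [])
                  (codeList codeSubset (extend B F)) (n * (21 + u * 12) + 3) 0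
  extend-cost u sm n≤u []      [] = match-nil↓ refl nil↓
  extend-cost u sm {suc n} n<u (b ∷ B) (f ∷ F) = step f
    where
    small : Small (codeList codeSubset (extend B F))
    small = ≤-trans (size-extend B F) (≤-trans (s≤s
      (*-mono-≤ (<⇒≤ n<u) (+-monoʳ-≤ 2 (*-monoˡ-≤ 4 (<⇒≤ n<u))))) sm)

    recursive = extend-cost u sm (<⇒≤ n<u) B F

    prepend : CallCost prependFun (codeBool b ∷ nil ∷ codeList codeSubset (extend B F) ∷ [])
                (codeList codeSubset (List.map (b ∷_) (extend B F))) (u * 12 + 3) 0
    prepend = relax (+-monoˡ-≤ 3 (*-monoˡ-≤ 12 (≤-trans (≤-reflexive (length-extend B F))
      (≤-trans (∣p∣≤n F) (<⇒≤ n<u))))) z≤n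
      (prepend-cost (b ∷_) codeSubset codeSubset (λ _ → refl) (extend B F))

    lemma : ∀ n u → 7 + (5 + (1 + (1 + (1 + (3 + (n * (21 + u * 12) + 3) + 0)) + (u * 12 + 3)))) ≡
            suc n * (21 + u * 12) + 3
    lemma = solve-∀

    step : ∀ f → CallCost extendFun (codeSubset (b ∷ B) ∷ codeSubset (f ∷ F) ∷ [])
             (codeList codeSubset (extend (b ∷ B) (f ∷ F))) (suc n * (21 + u * 12) + 3) 0
    step false = relax (≤-trans (m≤n+m _ 6) (≤-reflexive (lemma n u))) z≤n
      (match-cons↓ refl (match-cons↓ refl (match-nil↓ refl
      (call↓ (2F ∷↓ (small-nil ⊢ nil↓ ◂ (small ⊢ self↓ (3F ∷↓ 1F ∷↓ []↓) recursive ◂ []↓))) prepend))))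
    step true = relax (≤-reflexive (lemma n u)) z≤n
      (match-cons↓ refl (match-cons↓ refl (match-cons↓ refl (cons↓
      (cons↓ true↓ (var↓ 5F))
      (call↓ (4F ∷↓ (small-nil ⊢ nil↓ ◂ (small ⊢ self↓ (5F ∷↓ 3F ∷↓ []↓) recursive ◂ []↓))) prepend)))))

-- Combinatorics of partial solutions

infix 4 _⊑_

_⊑_ : ∀ {n l} → Vec (Subset n) l → Vec (Subset n) l → Set
_⊑_ = Pointwise _⊆_

total : ∀ {n l} → Vec (Subset n) l → ℕ
total Bs = Vec.sum (Vec.map ∣_∣ Bs)

x∈p─q⇒x∉q : ∀ {n x} (p q : Subset n) → x ∈ p ─ q → x ∉ q
x∈p─q⇒x∉q (_ ∷ p) (false ∷ q) (there x∈) (there x∈q) = x∈p─q⇒x∉q p q x∈ x∈q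
x∈p─q⇒x∉q (_ ∷ p) (true ∷ q)  (there x∈) (there x∈q) = x∈p─q⇒x∉q p q x∈ x∈q

∣p∪q∣≤∣p∣+∣q∣ : ∀ {n} (p q : Subset n) → ∣ p ∪ q ∣ ≤ ∣ p ∣ + ∣ q ∣
∣p∪q∣≤∣p∣+∣q∣ []          []          = z≤n
∣p∪q∣≤∣p∣+∣q∣ (false ∷ p) (false ∷ q) = ∣p∪q∣≤∣p∣+∣q∣ p q
∣p∪q∣≤∣p∣+∣q∣ (false ∷ p) (true ∷ q)  =
  ≤-trans (s≤s (∣p∪q∣≤∣p∣+∣q∣ p q)) (≤-reflexive (sym (+-suc ∣ p ∣ ∣ q ∣)))
∣p∪q∣≤∣p∣+∣q∣ (true ∷ p)  (b ∷ q)     =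
  s≤s (≤-trans (∣p∪q∣≤∣p∣+∣q∣ p q) (+-monoʳ-≤ ∣ p ∣ (∣p∣≤∣x∷p∣ b q)))

∣unions∣≤total : ∀ {n l} (Bs : Vec (Subset n) l) → ∣ unions Bs ∣ ≤ total Bs
∣unions∣≤total {n} []       = ≤-reflexive (∣⊥∣≡0 n)
∣unions∣≤total     (B ∷ Bs) =
  ≤-trans (∣p∪q∣≤∣p∣+∣q∣ B (unions Bs)) (+-monoʳ-≤ ∣ B ∣ (∣unions∣≤total Bs))

lookup⊆unions : ∀ {n l} (Bs : Vec (Subset n) l) i → lookup Bs i ⊆ unions Bs
lookup⊆unions (B ∷ Bs) zero    = p⊆p∪q (unions Bs)
lookup⊆unions (B ∷ Bs) (suc i) = q⊆p∪q B (unions Bs) ∘ lookup⊆unions Bs i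

total-mono : ∀ {n l} {As Bs : Vec (Subset n) l} → As ⊑ Bs → total As ≤ total Bs
total-mono []             = z≤n
total-mono (A⊆B ∷ As⊑Bs) = +-mono-≤ (p⊆q⇒∣p∣≤∣q∣ A⊆B) (total-mono As⊑Bs)

total≡sum : ∀ {n l} (ks : Vec ℕ l) (As : Vec (Subset n) l) →
            (∀ i → ∣ lookup As i ∣ ≡ lookup ks i) → total As ≡ Vec.sum ks
total≡sum []       []       eq = refl
total≡sum (k ∷ ks) (A ∷ As) eq = cong₂ _+_ (eq zero) (total≡sum ks As (eq ∘ suc))

∷-⊆ : ∀ {n a b} {p q r : Subset n} → b ∷ p ⊆ a ∷ q → r ⊆ q → b ∷ r ⊆ a ∷ q
∷-⊆ b∷p⊆a∷q r⊆q here with b∷p⊆a∷q here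
... | here = here
∷-⊆ b∷p⊆a∷q r⊆q (there x∈r) = there (r⊆q x∈r)

-- The witness is the extension by `x` itself. This is how a correct guess passes to a child.
extend-covers : ∀ {n x} {A : Subset n} (B F : Subset n) → B ⊆ A → x ∈ A → x ∈ F →
                Any (_⊆ A) (extend B F)
extend-covers (b ∷ B) (true ∷ F) B⊆A here here =
  here λ { here → here ; (there x∈B) → there (drop-∷-⊆ B⊆A x∈B) }
extend-covers (b ∷ B) (false ∷ F) B⊆A (there x∈A) (there x∈F) =
  Any.map⁺ (Any.map (∷-⊆ B⊆A) (extend-covers B F (drop-∷-⊆ B⊆A) x∈A x∈F))
extend-covers (b ∷ B) (true ∷ F) B⊆A (there x∈A) (there x∈F) =
  there (Any.map⁺ (Any.map (∷-⊆ B⊆A) (extend-covers B F (drop-∷-⊆ B⊆A) x∈A x∈F)))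

-- Disjointness makes every added element new, which is the progress that the fuel measures.
∣extend∣ : ∀ {n} (B F : Subset n) → (∀ {x} → x ∈ F → x ∉ B) →
           Allᴸ (λ C → ∣ C ∣ ≡ suc ∣ B ∣) (extend B F)
∣extend∣ []          []          disjoint = []
∣extend∣ (false ∷ B) (false ∷ F) disjoint =
  Allᴸ.map⁺ (∣extend∣ B F λ x∈F x∈B → disjoint (there x∈F) (there x∈B))
∣extend∣ (true ∷ B)  (false ∷ F) disjoint =
  Allᴸ.map⁺ (Allᴸ.map (cong suc) (∣extend∣ B F λ x∈F x∈B → disjoint (there x∈F) (there x∈B)))
∣extend∣ (false ∷ B) (true ∷ F)  disjoint =
  refl ∷ Allᴸ.map⁺ (∣extend∣ B F λ x∈F x∈B → disjoint (there x∈F) (there x∈B))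
∣extend∣ (true ∷ B)  (true ∷ F)  disjoint = contradiction here (disjoint here)

-- The parts Cᵢ = Aᵢ ─ Bᵢ are exchanged for Lᵢ = Jᵢ ─ Bᵢ, keeping Kᵢ = Jᵢ ∩ Bᵢ.
replacement-≤𝒟 : ∀ {n l} (Bs As Js : Vec (Subset n) l) → Bs ⊑ As →
  (∀ i → ∣ lookup As i ∣ ≡ ∣ lookup Js i ∣) →
  (∀ i j → i ≢ j → ∀ {x} → x ∈ lookup Js i → x ∉ lookup Bs i → x ∈ lookup Js j → x ∉ lookup Bs j → ⊥) →
  (∀ i j {x} → x ∈ lookup Js i → x ∉ lookup Bs i → x ∉ lookup Bs j) →
  As ≤𝒟 Js
replacement-≤𝒟 Bs As Js Bs⊑As ∣A∣≡∣J∣ disjoint fresh = record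
  { B = lookup Bs
  ; C = λ i → lookup As i ─ lookup Bs i
  ; K = λ i → lookup Js i ∩ lookup Bs i
  ; L = λ i → lookup Js i ─ lookup Bs i
  ; A≐B⊎C = λ i → split (lookup As i) (lookup Bs i) (Pointwise.lookup Bs⊑As i) ,
      λ (x , x∈) → let (x∈B , x∈C) = x∈p∩q⁻ _ _ x∈ in x∈p─q⇒x∉q _ _ x∈C x∈B
  ; J≐K⊎L = λ i → split′ (lookup Js i) (lookup Bs i) ,
      λ (x , x∈) → let (x∈K , x∈L) = x∈p∩q⁻ _ _ x∈ in x∈p─q⇒x∉q _ _ x∈L (p∩q⊆q _ _ x∈K)
  ; K⊆B = λ i → p∩q⊆q _ _
  ; ∣A∣≡∣J∣ = ∣A∣≡∣J∣
  ; L∩L-empty = λ i j i≢j (x , x∈) → let (x∈Lᵢ , x∈Lⱼ) = x∈p∩q⁻ _ _ x∈ in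
      disjoint i j i≢j (p─q⊆p _ _ x∈Lᵢ) (x∈p─q⇒x∉q _ _ x∈Lᵢ) (p─q⊆p _ _ x∈Lⱼ) (x∈p─q⇒x∉q _ _ x∈Lⱼ)
  ; L∩B-empty = λ i j (x , x∈) → let (x∈L , x∈B) = x∈p∩q⁻ _ _ x∈ in
      fresh i j (p─q⊆p _ _ x∈L) (x∈p─q⇒x∉q _ _ x∈L) x∈B
  }
  where
  split : ∀ {n} (A B : Subset n) → B ⊆ A → A ≡ B ∪ (A ─ B)
  split []          []          B⊆A = refl
  split (a ∷ A)     (false ∷ B) B⊆A = cong (a ∷_) (split A B (drop-∷-⊆ B⊆A))
  split (true ∷ A)  (true ∷ B)  B⊆A = cong (true ∷_) (split A B (drop-∷-⊆ B⊆A))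
  split (false ∷ A) (true ∷ B)  B⊆A = contradiction (B⊆A here) λ ()

  split′ : ∀ {n} (J B : Subset n) → J ≡ (J ∩ B) ∪ (J ─ B)
  split′ []          []          = refl
  split′ (false ∷ J) (false ∷ B) = cong (false ∷_) (split′ J B)
  split′ (true ∷ J)  (false ∷ B) = cong (true ∷_) (split′ J B)
  split′ (false ∷ J) (true ∷ B)  = cong (false ∷_) (split′ J B)
  split′ (true ∷ J)  (true ∷ B)  = cong (true ∷_) (split′ J B)

-- The two outcomes of a sweep

module Outcomes (Φ : ImplicitSetSystem) (I : Instance) where

  Sub : Set
  Sub = Subset (∣U∣ Φ I)

  Valid : ∀ {l} → Vec ℕ l → Vec Sub l → Set
  Valid ks As = (∀ i → Feasible (Φ I) (lookup As i)) × (∀ i → ∣ lookup As i ∣ ≡ lookup ks i)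

  valid-tail : ∀ {l k A} {ks : Vec ℕ l} {As} → Valid (k ∷ ks) (A ∷ As) → Valid ks As
  valid-tail (feasible , size) = feasible ∘ suc , size ∘ suc

  -- At the start of a sweep `G` is the union of the guesses; further on it also contains the sets
  -- already chosen. So `fresh` gives disjointness from all Bⱼ at the start, and from the earlier Jⱼ
  -- later.
  record Packing {l} (G : Sub) (ks : Vec ℕ l) (Bs : Vec Sub l) (d : Data) : Set where
    field
      Js       : Vec Sub l
      code≡    : d ≡ cons (codeBool true) (codeVec codeSubset Js)
      valid    : Valid ks Js
      fresh    : ∀ i {x} → x ∈ lookup Js i → x ∉ lookup Bs i → x ∉ G
      disjoint : ∀ i j → i ≢ j → ∀ {x} → x ∈ lookup Js i → x ∉ lookup Bs i →
                 x ∈ lookup Js j → x ∉ lookup Bs j → ⊥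

  -- The bound in `few` is the most that `G` can hold once every remaining call has succeeded. It
  -- therefore survives moving a set of size k from the sizes still due into `G`. Since `covering`
  -- speaks of all valid tuples, diverse or not, the sweep can be analysed without 𝔻.
  record Branching {l} (G : Sub) (ks : Vec ℕ l) (Bs : Vec Sub l) (d : Data) : Set where
    field
      children : List (Vec Sub l)
      code≡    : d ≡ cons (codeBool false) (codeList (codeState ks) children)
      few      : length children ≤ ∣ G ∣ + Vec.sum ks
      larger   : Allᴸ (λ C → total C ≡ suc (total Bs)) children
      covering : ∀ As → Valid ks As → Bs ⊑ As → Any (_⊑ As) children

  Outcome : ∀ {l} → Sub → Vec ℕ l → Vec Sub l → Data → Set
  Outcome G ks Bs d = Packing G ks Bs d ⊎ Branching G ks Bs d

  size-outcome : ∀ {l G d S Γ} (ks : Vec ℕ l) (Bs : Vec Sub l) →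
                 size (codeVec codeUnary ks) + l * (2 + ∣U∣ Φ I * 4) ≤ S → ∣ G ∣ + Vec.sum ks ≤ Γ →
                 Outcome G ks Bs d → size d ≤ 5 + S + Γ * (1 + S)
  size-outcome {l} {G} {d} {S} {Γ} ks Bs S≤ Γ≤ (inj₁ packing) = begin
    size d                              ≡⟨ cong size code≡ ⟩
    4 + size (codeVec codeSubset Js)    ≤⟨ +-monoʳ-≤ 4 (size-codeVec codeSubset size-codeSubset Js) ⟩
    5 + l * (2 + ∣U∣ Φ I * 4)           ≤⟨ +-monoʳ-≤ 5 (≤-trans (m≤n+m _ (size (codeVec codeUnary ks))) S≤) ⟩
    5 + S                               ≤⟨ m≤m+n (5 + S) (Γ * (1 + S)) ⟩
    5 + S + Γ * (1 + S)                 ∎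
    where
    open ≤-Reasoning
    open Packing packing
  size-outcome {l} {G} {d} {S} {Γ} ks Bs S≤ Γ≤ (inj₂ branching) = begin
    size d                                        ≡⟨ cong size code≡ ⟩
    2 + size (codeList (codeState ks) children)
      ≤⟨ +-monoʳ-≤ 2 (size-codeList (codeState ks) (λ Bs → ≤-trans (size-codeState ks Bs) S≤) children) ⟩
    3 + length children * (1 + S)                 ≤⟨ +-monoʳ-≤ 3 (*-monoˡ-≤ (1 + S) (≤-trans few Γ≤)) ⟩
    3 + Γ * (1 + S)                               ≤⟨ +-monoˡ-≤ (Γ * (1 + S)) (m≤m+n 3 (2 + S)) ⟩
    5 + S + Γ * (1 + S)                           ∎
    where
    open ≤-Reasoning
    open Branching branching

  -- The new parts of the later sets avoid G ∪ J. Avoiding `J` yields the new disjointness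
  -- conditions, avoiding `G` keeps freshness.
  cons-packing : ∀ {l G k B J v} {ks : Vec ℕ l} {Bs} →
    Feasible (Φ I) J → ∣ J ∣ ≡ k → Empty (J ∩ (G ─ B)) →
    Packing (G ∪ J) ks Bs (cons (codeBool true) v) →
    Packing G (k ∷ ks) (B ∷ Bs) (cons (codeBool true) (cons (codeSubset J) v))
  cons-packing {G = G} {B = B} {J} feasible ∣J∣≡k empty packing = record
    { Js       = J ∷ Js
    ; code≡    = cong (λ { (cons t v) → cons t (cons (codeSubset J) v) ; nil → nil }) code≡
    ; valid    = (λ { zero → feasible ; (suc i) → proj₁ valid i }) ,
                 (λ { zero → ∣J∣≡k ; (suc i) → proj₂ valid i })
    ; fresh    = λ { zero x∈J x∉B x∈G → empty (_ , x∈p∩q⁺ (x∈J , x∈p∧x∉q⇒x∈p─q x∈G x∉B))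
                   ; (suc i) x∈J x∉B x∈G → fresh i x∈J x∉B (p⊆p∪q J x∈G) }
    ; disjoint = λ { zero    zero    0≢0 _ _ _ _ → 0≢0 refl
                   ; zero    (suc j) _ x∈J _ x∈Jⱼ x∉Bⱼ → fresh j x∈Jⱼ x∉Bⱼ (q⊆p∪q G J x∈J)
                   ; (suc i) zero    _ x∈Jᵢ x∉Bᵢ x∈J _ → fresh i x∈Jᵢ x∉Bᵢ (q⊆p∪q G J x∈J)
                   ; (suc i) (suc j) i≢j → disjoint i j (i≢j ∘ cong suc) }
    }
    where open Packing packing

  -- Children of a later failure leave the head guess alone. The bound on their number is also
  -- returned by itself, as it bounds the cost of putting the head back.
  cons-branching : ∀ {l G k B J d} {ks : Vec ℕ l} {Bs} → ∣ J ∣ ≡ k →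
    (branching : Branching (G ∪ J) ks Bs d) → let open Branching branching in
    length children ≤ ∣ G ∣ + Vec.sum (k ∷ ks) ×
    Branching G (k ∷ ks) (B ∷ Bs)
      (cons (codeBool false) (codeList (codeState (k ∷ ks)) (List.map (B ∷_) children)))
  cons-branching {G = G} {k} {B} {J} {ks = ks} {Bs} ∣J∣≡k branching = few′ , record
    { children = List.map (B ∷_) children
    ; code≡    = refl
    ; few      = ≤-trans (≤-reflexive (length-map (B ∷_) children)) few′
    ; larger   = Allᴸ.map⁺ (Allᴸ.map (λ eq → trans (cong (∣ B ∣ +_) eq) (+-suc ∣ B ∣ (total Bs))) larger)
    ; covering = λ { (A ∷ As) valid (B⊆A ∷ Bs⊑As) →
        Any.map⁺ (Any.map (B⊆A ∷_) (covering As (valid-tail valid) Bs⊑As)) }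
    }
    where
    open Branching branching
    few′ : length children ≤ ∣ G ∣ + (k + Vec.sum ks)
    few′ = begin
      length children              ≤⟨ few ⟩
      ∣ G ∪ J ∣ + Vec.sum ks       ≤⟨ +-monoˡ-≤ (Vec.sum ks) (∣p∪q∣≤∣p∣+∣q∣ G J) ⟩
      ∣ G ∣ + ∣ J ∣ + Vec.sum ks   ≡⟨ cong (λ k → ∣ G ∣ + k + Vec.sum ks) ∣J∣≡k ⟩
      ∣ G ∣ + k + Vec.sum ks       ≡⟨ +-assoc ∣ G ∣ k (Vec.sum ks) ⟩
      ∣ G ∣ + (k + Vec.sum ks)     ∎
      where open ≤-Reasoning

  branching-here : ∀ {l} G k B (ks : Vec ℕ l) Bs →
    ¬ (∃[ J ] Feasible (Φ I) J × ∣ J ∣ ≡ k × Empty (J ∩ (G ─ B))) →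
    Branching G (k ∷ ks) (B ∷ Bs) (cons (codeBool false)
      (codeList (codeState (k ∷ ks)) (List.map (_∷ Bs) (extend B (G ─ B)))))
  branching-here G k B ks Bs none = record
    { children = List.map (_∷ Bs) (extend B (G ─ B))
    ; code≡    = refl
    ; few      = begin
        length (List.map (_∷ Bs) (extend B (G ─ B))) ≡⟨ length-map (_∷ Bs) (extend B (G ─ B)) ⟩
        length (extend B (G ─ B))                    ≡⟨ length-extend B (G ─ B) ⟩
        ∣ G ─ B ∣                                    ≤⟨ ∣p─q∣≤∣p∣ G B ⟩
        ∣ G ∣                                        ≤⟨ m≤m+n ∣ G ∣ _ ⟩
        ∣ G ∣ + Vec.sum (k ∷ ks)                     ∎
    ; larger   = Allᴸ.map⁺ (Allᴸ.map (cong (_+ total Bs)) (∣extend∣ B (G ─ B) (x∈p─q⇒x∉q G B)))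
    ; covering = covering
    }
    where
    open ≤-Reasoning
    covering : ∀ As → Valid (k ∷ ks) As → (B ∷ Bs) ⊑ As → Any (_⊑ As) (List.map (_∷ Bs) (extend B (G ─ B)))
    covering (A ∷ As) (feasible , size) (B⊆A ∷ Bs⊑As) with nonempty? (A ∩ (G ─ B))
    -- `A` itself would answer the failed query.
    ... | no empty = contradiction (A , feasible zero , size zero , empty) none
    ... | yes (x , x∈) = let (x∈A , x∈F) = x∈p∩q⁻ A (G ─ B) x∈ in
      Any.map⁺ (Any.map (_∷ Bs⊑As) (extend-covers B (G ─ B) B⊆A x∈A x∈F))

-- Cost and correctness of a sweep

sweepWork : ℕ → ℕ → ℕ → ℕ
-- One price for the three ways a step can go. The term 38n pays for two set differences and one
-- `wrapFun`, the quadratic term for `extendFun`, and 12Γ for prepending the head to at most Γ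
-- children.
sweepWork n Γ q = q + (40 + n * 38 + n * (21 + n * 12) + Γ * 12)

module Sweep {Ω : Set} (O : Ω → Data → Data) (metering : Metering Ω)
             (Φ : ImplicitSetSystem) (I : Instance) (forb thr univ : Function Ω 1)
             (M S Γ k qf : ℕ) (M>0 : 1 ≤ M)
             (M-extend : 1 + ∣U∣ Φ I * (2 + ∣U∣ Φ I * 4) ≤ M)
             (M-query : 3 + size (codeInstance I) + S + ∣U∣ Φ I * 4 ≤ M)
             (M-outcome : 5 + S + Γ * (1 + S) ≤ M) where
  open Calculus O metering M M>0
  open Library O metering M M>0
  open Algorithm forb thr univ
  open Outcomes Φ I

  private
    n = ∣U∣ Φ I

  forbiddenInput : ℕ → Sub → ForbiddenInput Φ
  forbiddenInput s F = record { I = I ; s = s ; Forb = F }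

  forbiddenQuery : ℕ → Sub → Data
  forbiddenQuery s F = code (ForbiddenSubset Φ) (forbiddenInput s F)

  Answered : ℕ → Sub → Set
  Answered s F = ∃[ d ] Correct (ForbiddenSubset Φ) (forbiddenInput s F) d ×
                        CallCost forb (forbiddenQuery s F ∷ []) d qf 1

  -- Limited to queries of bounded size and parameter: only for these can one `qf` bound the cost of
  -- a fixed-parameter solver, and the bound on the parameter is itself part of the claim on oracle
  -- calls.
  Answers : Set
  Answers = ∀ s F → Small (forbiddenQuery s F) → s + ∣ F ∣ ≤ k + Γ → Answered s F

  subset-small : ∀ F → Small (codeSubset {n} F)
  subset-small F = begin
    size (codeSubset F)                                ≤⟨ size-codeSubset F ⟩
    1 + n * 4
      ≤⟨ +-monoˡ-≤ (n * 4) (m≤m+n 1 (2 + size (codeInstance I) + S)) ⟩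
    3 + size (codeInstance I) + S + n * 4              ≤⟨ M-query ⟩
    M                                                  ∎
    where open ≤-Reasoning

  module _ (answers : Answers) where

    -- The invariant on `G` counts the sizes still due, so adding a set of size k₀ preserves it
    -- while k₀ leaves the sum.
    sweep-cost : ∀ {l} G (ks : Vec ℕ l) Bs → size (codeVec codeUnary ks) + l * (2 + n * 4) ≤ S →
                 ∣ G ∣ + Vec.sum ks ≤ Γ → All (_≤ k) ks →
                 ∃[ d ] CallCost sweepFun (codeInstance I ∷ codeSubset G ∷ codeState ks Bs ∷ []) d
                          (l * sweepWork n Γ qf + 7) l × Outcome G ks Bs d
    sweep-cost G [] [] _ _ _ = _ , match-nil↓ refl (cons↓ true↓ nil↓) , inj₁ (record
      { Js = [] ; code≡ = refl ; valid = (λ ()) , (λ ()) ; fresh = λ () ; disjoint = λ () })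
    sweep-cost {suc l} G (k₀ ∷ ks) (B ∷ Bs) S≤ Γ≤ (k₀≤k ∷ ks≤k) = branch
      (answers k₀ (G ─ B) query-small param≤)
      where
      open ≤-Reasoning

      k₀≤S : size (codeUnary k₀) ≤ S
      k₀≤S = begin
        size (codeUnary k₀)                                    ≤⟨ m≤m+n _ _ ⟩
        size (codeUnary k₀) + size (codeVec codeUnary ks)      ≤⟨ n≤1+n _ ⟩
        size (codeVec codeUnary (k₀ ∷ ks))                     ≤⟨ m≤m+n _ _ ⟩
        size (codeVec codeUnary (k₀ ∷ ks)) + suc l * (2 + n * 4) ≤⟨ S≤ ⟩
        S                                                      ∎

      query-small : Small (forbiddenQuery k₀ (G ─ B))
      query-small = begin
        suc (size (codeInstance I) + suc (size (codeUnary k₀) + size (codeSubset (G ─ B))))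
          ≤⟨ s≤s (+-monoʳ-≤ (size (codeInstance I)) (s≤s (+-mono-≤ k₀≤S (size-codeSubset (G ─ B))))) ⟩
        suc (size (codeInstance I) + suc (S + suc (n * 4)))
          ≡⟨ lemma (size (codeInstance I)) S n ⟩
        3 + size (codeInstance I) + S + n * 4
          ≤⟨ M-query ⟩
        M ∎
        where
        lemma : ∀ i s n → suc (i + suc (s + suc (n * 4))) ≡ 3 + i + s + n * 4
        lemma = solve-∀

      param≤ : k₀ + ∣ G ─ B ∣ ≤ k + Γ
      param≤ = +-mono-≤ k₀≤k (≤-trans (∣p─q∣≤∣p∣ G B) (≤-trans (m≤m+n _ _) Γ≤))

      S′≤ : size (codeVec codeUnary ks) + l * (2 + n * 4) ≤ S
      S′≤ = ≤-trans (+-mono-≤ (≤-trans (m≤n+m _ (size (codeUnary k₀))) (n≤1+n _)) (m≤n+m _ (2 + n * 4))) S≤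

      A = 40 + n * 38 + n * (21 + n * 12) + Γ * 12

      query↓ : ∀ {d} {body : Term Ω 3 3} {a b c} →
        CallCost forb (forbiddenQuery k₀ (G ─ B) ∷ []) d qf 1 →
        Cost body (codeUnary k₀ ∷ codeSubset B ∷ a ∷ b ∷ codeInstance I ∷ codeSubset G ∷ c ∷ [])
          (call forb (cons v4 (cons v0 (call diffFun (v5 ∷ v1 ∷ []))) ∷ [])) d (11 + n * 13 + qf) 1
      query↓ forb↓ = relax (≤-reflexive (lemma n qf)) ≤-refl
        (call↓ (query-small ⊢ cons↓ (var↓ 4F) (cons↓ (var↓ 0F)
          (call↓ (5F ∷↓ 1F ∷↓ []↓) (diff-cost G B))) ◂ []↓) forb↓)
        where
        lemma : ∀ n q → 1 + (7 + (n * 13 + 3) + 0 + q) ≡ 11 + n * 13 + q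
        lemma = solve-∀

      branch : Answered k₀ (G ─ B) →
               ∃[ d ] CallCost sweepFun (codeInstance I ∷ codeSubset G ∷ codeState (k₀ ∷ ks) (B ∷ Bs) ∷ []) d
                 (suc l * sweepWork n Γ qf + 7) (suc l) × Outcome G (k₀ ∷ ks) (B ∷ Bs) d
      branch (d , inj₂ (refl , none) , forb↓) = _ ,
        relax (≤-slack (12 + l * (qf + A) + Γ * 12) (lemma l n Γ qf)) (s≤s z≤n)
          (match-cons↓ refl (match-cons↓ refl (case-nil↓ (query↓ forb↓) (cons↓ nil↓
            (call↓ (0F ∷↓ 3F ∷↓ (≤-trans (size-extend B (G ─ B)) M-extend ⊢
                call↓ (1F ∷↓ (subset-small (G ─ B) ⊢ call↓ (5F ∷↓ 1F ∷↓ []↓) (diff-cost G B) ◂ []↓))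
                  (extend-cost n M-extend ≤-refl B (G ─ B)) ◂ []↓))
              (relax (+-monoˡ-≤ 3 (*-monoˡ-≤ 12 (≤-trans (≤-reflexive (length-extend B (G ─ B)))
                (∣p∣≤n (G ─ B))))) z≤n
                (wrap-cost (_∷ Bs) codeSubset (codeState (k₀ ∷ ks)) (λ _ → refl) (extend B (G ─ B))))))))) ,
        inj₂ (branching-here G k₀ B ks Bs λ { (J , solution) → none (J , solution) })
        where
        lemma : ∀ l n Γ q →
          5 + (11 + n * 13 + q + (2 + (1 + (2 + (1 +
            (1 + (3 + (n * 13 + 3) + 0) + (n * (21 + n * 12) + 3)) + 0) + (n * 12 + 3))))) +
            (12 + l * (q + (40 + n * 38 + n * (21 + n * 12) + Γ * 12)) + Γ * 12) ≡
          suc l * (q + (40 + n * 38 + n * (21 + n * 12) + Γ * 12)) + 7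
        lemma = solve-∀
      branch (d , inj₁ (J , refl , feasible , ∣J∣≡k , empty) , forb↓) =
        continue (sweep-cost (G ∪ J) ks Bs S′≤ Γ′≤ ks≤k)
        where
        Γ′≤ : ∣ G ∪ J ∣ + Vec.sum ks ≤ Γ
        Γ′≤ = begin
          ∣ G ∪ J ∣ + Vec.sum ks      ≤⟨ +-monoˡ-≤ (Vec.sum ks) (∣p∪q∣≤∣p∣+∣q∣ G J) ⟩
          ∣ G ∣ + ∣ J ∣ + Vec.sum ks  ≡⟨ +-assoc ∣ G ∣ ∣ J ∣ (Vec.sum ks) ⟩
          ∣ G ∣ + (∣ J ∣ + Vec.sum ks) ≡⟨ cong (λ k → ∣ G ∣ + (k + Vec.sum ks)) ∣J∣≡k ⟩
          ∣ G ∣ + (k₀ + Vec.sum ks)   ≤⟨ Γ≤ ⟩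
          Γ                           ∎

        answer-small : Small (cons nil (codeSubset J))
        answer-small = begin
          2 + size (codeSubset J)                ≤⟨ +-monoʳ-≤ 2 (size-codeSubset J) ⟩
          3 + n * 4                              ≤⟨ +-monoˡ-≤ (n * 4) (m≤m+n 3 (size (codeInstance I) + S)) ⟩
          3 + (size (codeInstance I) + S) + n * 4 ≤⟨ M-query ⟩
          M                                      ∎

        continue : (∃[ d ] CallCost sweepFun (codeInstance I ∷ codeSubset (G ∪ J) ∷ codeState ks Bs ∷ []) d
                      (l * sweepWork n Γ qf + 7) l × Outcome (G ∪ J) ks Bs d) → _
        continue (d , sweep↓ , outcome) with ≤-trans (size-outcome ks Bs S′≤ Γ′≤ outcome) M-outcome
        continue (nil , sweep↓ , inj₁ record { code≡ = () }) | _
        continue (nil , sweep↓ , inj₂ record { code≡ = () }) | _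
        continue (cons _ v , sweep↓ , inj₁ packing@(record { code≡ = refl })) | sm = _ ,
          relax (≤-slack (5 + n * 12 + n * (21 + n * 12) + Γ * 12) (lemma l n Γ qf))
            (≤-reflexive (cong suc (+-identityʳ l)))
            (match-cons↓ refl (match-cons↓ refl (case-cons↓ answer-small (query↓ forb↓)
              (case-cons↓ sm (self↓ (6F ∷↓ (subset-small (G ∪ J) ⊢ call↓ (7F ∷↓ 1F ∷↓ []↓)
                (union-cost G J) ◂ 5F ∷↓ []↓)) sweep↓)
                (match-cons↓ refl (cons↓ true↓ (cons↓ (var↓ 5F) (var↓ 3F)))))))) ,
          inj₁ (cons-packing feasible ∣J∣≡k empty packing)
          where
          lemma : ∀ l n Γ q →
            5 + (11 + n * 13 + q + (1 + (1 + (1 + (3 + (n * 13 + 3) + 1) +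
              (l * (q + (40 + n * 38 + n * (21 + n * 12) + Γ * 12)) + 7)) + 9))) +
              (5 + n * 12 + n * (21 + n * 12) + Γ * 12) ≡
            suc l * (q + (40 + n * 38 + n * (21 + n * 12) + Γ * 12)) + 7
          lemma = solve-∀
        continue (cons _ v , sweep↓ , inj₂ branching@(record { code≡ = refl })) | sm
          with cons-branching {B = B} ∣J∣≡k branching
        ... | few , branching′ = _ ,
          relax (≤-slack (3 + n * 12 + n * (21 + n * 12)) (lemma l n Γ qf))
            (≤-reflexive (cong suc (+-identityʳ l)))
            (match-cons↓ refl (match-cons↓ refl (case-cons↓ answer-small (query↓ forb↓)
              (case-cons↓ sm (self↓ (6F ∷↓ (subset-small (G ∪ J) ⊢ call↓ (7F ∷↓ 1F ∷↓ []↓)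
                (union-cost G J) ◂ 5F ∷↓ []↓)) sweep↓)
                (match-nil↓ refl (cons↓ nil↓ (call↓ (6F ∷↓ (small-nil ⊢ nil↓ ◂ 1F ∷↓ []↓))
                  (relax (+-monoˡ-≤ 3 (*-monoˡ-≤ 12 (≤-trans few Γ≤))) z≤n
                    (prepend-cost (B ∷_) (codeState ks) (codeState (k₀ ∷ ks)) (λ _ → refl)
                      (Branching.children branching)))))))))) ,
          inj₂ branching′
          where
          lemma : ∀ l n Γ q →
            5 + (11 + n * 13 + q + (1 + (1 + (1 + (3 + (n * 13 + 3) + 1) +
              (l * (q + (40 + n * 38 + n * (21 + n * 12) + Γ * 12)) + 7)) +
              (2 + (2 + (1 + (3 + (Γ * 12 + 3)))))))) +
              (3 + n * 12 + n * (21 + n * 12)) ≡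
            suc l * (q + (40 + n * 38 + n * (21 + n * 12) + Γ * 12)) + 7
          lemma = solve-∀

-- The search tree

-- Control flow, the union of the guesses, the sweep and one comparison with b.
nodeWork : ℕ → ℕ → ℕ → ℕ → ℕ → ℕ
nodeWork n r Γ qf qt = 41 + r * (12 + n * 13) + r * sweepWork n Γ qf + qt

-- The weight of a search tree of height h whose nodes have weight w and at
-- most m children.
treeWork : ℕ → ℕ → ℕ → ℕ
treeWork m w zero    = w
treeWork m w (suc h) = w + m * treeWork m w h

-- Replacing the geometric sum by a power of 1 + m is what makes the base 2n when m = 2n - 1. It is
-- used with w as time and with w = r as number of calls.
treeWork≤ : ∀ m w h → treeWork m w h ≤ w * (1 + m) ^ h
treeWork≤ m w zero    = ≤-reflexive (sym (*-identityʳ w))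
treeWork≤ m w (suc h) = begin
  w + m * treeWork m w h
    ≤⟨ +-mono-≤ (m≤m*n w ((1 + m) ^ h) {{m^n≢0 (1 + m) h}}) (*-monoʳ-≤ m (treeWork≤ m w h)) ⟩
  w * (1 + m) ^ h + m * (w * (1 + m) ^ h)     ≡⟨ lemma m w ((1 + m) ^ h) ⟩
  w * ((1 + m) * (1 + m) ^ h)                 ∎
  where
  open ≤-Reasoning
  lemma : ∀ m w p → w * p + m * (w * p) ≡ w * ((1 + m) * p)
  lemma = solve-∀

≤treeWork : ∀ m w h → w ≤ treeWork m w h
≤treeWork m w zero    = ≤-refl
≤treeWork m w (suc h) = m≤m+n w (m * treeWork m w h)

charge : ∀ {c} e t l → c ≤ e + (l * t + 3) → e ≤ t → c ≤ suc l * t + 3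
charge e t l c≤ e≤t = ≤-trans c≤ (≤-trans (+-monoˡ-≤ (l * t + 3) e≤t)
  (≤-reflexive (sym (+-assoc t (l * t) 3))))

sum≤max*length : ∀ {l} (ks : Vec ℕ l) {k} → All (_≤ k) ks → Vec.sum ks ≤ k * l
sum≤max*length [] [] = z≤n
sum≤max*length {suc l} (k₀ ∷ ks) {k} (k₀≤k ∷ ks≤k) =
  ≤-trans (+-mono-≤ k₀≤k (sum≤max*length ks ks≤k)) (≤-reflexive (sym (*-suc k l)))

all≤max : ∀ {l} (ks : Vec ℕ l) → All (_≤ Vec.foldr′ _⊔_ 0 ks) ks
all≤max []       = []
all≤max (k ∷ ks) = m≤m⊔n k _ ∷ All.map (λ k′≤ → ≤-trans k′≤ (m≤n⊔m k _)) (all≤max ks)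

code-∅ : ∀ {n} (xs : Vec Data n) →
         codeList codeBool (List.map (λ _ → false) (toList xs)) ≡ codeSubset {n} ∅
code-∅ []       = refl
code-∅ (x ∷ xs) = cong (cons nil) (code-∅ xs)

code-root : ∀ {l n} (ks : Vec ℕ l) →
            codeList (λ k → cons (codeUnary k) (codeSubset {n} ∅)) (List.map (λ k → k) (toList ks)) ≡
            codeState ks (Vec.replicate l (∅ {n}))
code-root []       = refl
code-root (k ∷ ks) = cong (cons _) (code-root ks)

total-replicate-∅ : ∀ l {n} → total (Vec.replicate l (∅ {n})) ≡ 0
total-replicate-∅ zero        = refl
total-replicate-∅ (suc l) {n} = cong₂ _+_ (∣⊥∣≡0 n) (total-replicate-∅ l)

replicate-∅⊑ : ∀ {l n} (As : Vec (Subset n) l) → Vec.replicate l ∅ ⊑ As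
replicate-∅⊑ []       = []
replicate-∅⊑ (A ∷ As) = ⊥⊆ ∷ replicate-∅⊑ As

-- `S` bounds a coded state, `m` the number of children of an inner node, and `M` the values handled
-- by the search.
record Adequate (Φ : ImplicitSetSystem) (x : DiverseInput) (M S m : ℕ) : Set where
  open DiverseInput x
  private
    n = ∣U∣ Φ I
  field
    S-state     : size (codeVec codeUnary ks) + r * (2 + n * 4) ≤ S
    m-children  : Vec.sum ks + Vec.sum ks ≤ 1 + m
    M-extend    : 1 + n * (2 + n * 4) ≤ M
    M-query     : 3 + size (codeInstance I) + S + n * 4 ≤ M
    M-threshold : 3 + size (codeUniverse (universe (Φ I))) + S + size (codeBinary b) ≤ M
    M-outcome   : 5 + S + (Vec.sum ks + Vec.sum ks) * (1 + S) ≤ M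

module Search {Ω : Set} (O : Ω → Data → Data) (metering : Metering Ω)
              (Φ : ImplicitSetSystem) (𝔻 : DiversityFunction) (consistent : ConsistentlyDiverse 𝔻)
              (x : DiverseInput) (forb thr univ : Function Ω 1)
              (M S m qf qt qu : ℕ) (M>0 : 1 ≤ M)
              (adequate : Adequate Φ x M S m) where
  open Adequate adequate
  open DiverseInput x
  open Calculus O metering M M>0
  open Library O metering M M>0
  open Algorithm forb thr univ
  open Outcomes Φ I
  open Sweep O metering Φ I forb thr univ M S (Vec.sum ks + Vec.sum ks) k qf M>0 M-extend M-query M-outcome

  private
    n = ∣U∣ Φ I
    U = universe (Φ I)
    size* = Vec.sum ks
    Γ = size* + size*
    w = nodeWork n r Γ qf qt

  thresholdQuery : Vec Sub r → Data
  thresholdQuery Js = cons (codeUniverse U) (cons (codeVec codeSubset Js) (codeBinary b))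

  Judges : Set
  Judges = ∀ Js → Small (thresholdQuery Js) →
           ∃[ d ] Decides (b ≤ 𝔻 U Js) d × CallCost thr (thresholdQuery Js ∷ []) d qt 0

  Solution : Vec Sub r → Set
  Solution = DiverseSolution 𝔻 Φ x

  -- A negative verdict excludes only the solutions extending a listed state. For the root, whose
  -- guesses are empty, these are all solutions.
  Verdict : List (Vec Sub r) → Bool → Set
  Verdict ss true  = ∃ Solution
  Verdict ss false = ∀ As → Solution As → ¬ Any (_⊑ As) ss

  query-small : ∀ Js → Small (thresholdQuery Js)
  query-small Js = begin
    suc (size (codeUniverse U) + suc (size (codeVec codeSubset Js) + size (codeBinary b)))
      ≤⟨ s≤s (+-monoʳ-≤ (size (codeUniverse U)) (s≤s (+-monoˡ-≤ (size (codeBinary b)) Js≤S))) ⟩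
    suc (size (codeUniverse U) + suc (1 + S + size (codeBinary b)))
      ≡⟨ lemma (size (codeUniverse U)) S (size (codeBinary b)) ⟩
    3 + size (codeUniverse U) + S + size (codeBinary b)
      ≤⟨ M-threshold ⟩
    M ∎
    where
    open ≤-Reasoning
    Js≤S : size (codeVec codeSubset Js) ≤ 1 + S
    Js≤S = ≤-trans (size-codeVec codeSubset size-codeSubset Js)
      (s≤s (≤-trans (m≤n+m _ (size (codeVec codeUnary ks))) S-state))
    lemma : ∀ u s b → suc (u + suc (1 + s + b)) ≡ 3 + u + s + b
    lemma = solve-∀

  bool-small : ∀ β → Small (codeBool β)
  bool-small β = ≤-trans (size-codeBool β) (≤-trans (m≤m+n 3 _) M-query)

  packing-dominates : ∀ {Bs d As} (packing : Packing (unions Bs) ks Bs d) → Bs ⊑ As → Solution As →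
                      𝔻 U As ≤ 𝔻 U (Packing.Js packing)
  packing-dominates {Bs} {As = As} packing Bs⊑As (_ , sizes , _) = consistent U As Js
    (replacement-≤𝒟 Bs As Js Bs⊑As (λ i → trans (sizes i) (sym (proj₂ valid i))) disjoint
      λ i j x∈J x∉B x∈Bⱼ → fresh i x∈J x∉B (lookup⊆unions Bs j x∈Bⱼ))
    where open Packing packing

  -- Positive fuel means that Σ |Bᵢ| is still below Σ kᵢ. The one saved here is what keeps the base
  -- of the final bound at 2n instead of 2n + 1.
  children-bounded : ∀ {h} {Bs : Vec Sub r} → total Bs + suc h ≡ size* →
                     ∀ l → l ≤ ∣ unions Bs ∣ + size* → l ≤ m
  children-bounded {h} {Bs} eq l l≤ = s≤s⁻¹ (begin
    suc l                          ≤⟨ s≤s l≤ ⟩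
    suc (∣ unions Bs ∣ + size*)    ≤⟨ s≤s (+-monoˡ-≤ size* (∣unions∣≤total Bs)) ⟩
    suc (total Bs + size*)
      ≤⟨ +-monoˡ-≤ size* (≤-trans (s≤s (m≤m+n (total Bs) h))
        (≤-reflexive (trans (sym (+-suc (total Bs) h)) eq))) ⟩
    size* + size*                  ≤⟨ m-children ⟩
    1 + m                          ∎)
    where open ≤-Reasoning

  -- Justifies dropping a state without fuel: Σ |Bᵢ| already equals Σ kᵢ, and a covering child,
  -- larger by one, would lie inside `As`, whose total is only Σ kᵢ.
  no-covering-child : ∀ {G Bs d} → total Bs + 0 ≡ size* → Branching G ks Bs d →
                      ∀ As → Solution As → ¬ (Bs ⊑ As)
  no-covering-child {Bs = Bs} eq branching As (feasible , sizes , _) Bs⊑As =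
    let (larger′ , C⊑As) = Allᴸ.lookupAny larger (covering As (feasible , sizes) Bs⊑As) in
    1+n≰n (begin
      suc (total Bs)  ≡⟨ larger′ ⟨
      total (Any.lookup (covering As (feasible , sizes) Bs⊑As)) ≤⟨ total-mono C⊑As ⟩
      total As        ≡⟨ total≡sum ks As sizes ⟩
      size*           ≡⟨ eq ⟨
      total Bs + 0    ≡⟨ +-identityʳ (total Bs) ⟩
      total Bs        ∎)
    where
    open ≤-Reasoning
    open Branching branching

  SearchCost : ℕ → List (Vec Sub r) → Set
  SearchCost h ss = ∃[ β ]
    CallCost searchFun
      (codeInstance I ∷ codeUniverse U ∷ codeBinary b ∷ codeSubset {n} ∅ ∷ codeUnary h ∷
        codeList (codeState ks) ss ∷ [])
      (codeBool β) (length ss * treeWork m w h + 3) (length ss * treeWork m r h) ×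
    Verdict ss β

  module _ (answers : Answers) (judges : Judges) (ks≤k : All (_≤ k) ks) where

    search-cost : ∀ h ss → Allᴸ (λ Bs → total Bs + h ≡ size*) ss → SearchCost h ss
    search-cost h []         []         = false , match-nil↓ refl nil↓ , λ _ _ ()
    search-cost h (Bs ∷ ss) (eq ∷ eqs) =
      -- The siblings are analysed in advance. If the program stops early with a solution, their
      -- cost becomes slack. The recursion decreases the fuel, or keeps it and shortens the list.
      process h eq (search-cost h ss eqs) (sweep-cost answers (unions Bs) ks Bs S-state Γ≤ ks≤k)
      where
      open ≤-Reasoning
      T = λ h → treeWork m w h
      Q = λ h → treeWork m r h

      Γ≤ : ∣ unions Bs ∣ + size* ≤ Γ
      Γ≤ = +-monoˡ-≤ size* (≤-trans (∣unions∣≤total Bs) (≤-trans (m≤m+n (total Bs) h) (≤-reflexive eq)))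

      sweep↓ : ∀ {d s₁ s₂ s₃ s₄ s₅} {body : Term Ω 6 6} →
        CallCost sweepFun (codeInstance I ∷ codeSubset (unions Bs) ∷ codeState ks Bs ∷ []) d
          (r * sweepWork n Γ qf + 7) r →
        Cost body (codeState ks Bs ∷ s₁ ∷ codeInstance I ∷ s₂ ∷ s₃ ∷ codeSubset {n} ∅ ∷ s₄ ∷ s₅ ∷ [])
          (call sweepFun (v2 ∷ call unionsFun (v5 ∷ v0 ∷ []) ∷ v0 ∷ [])) d
          (16 + r * (12 + n * 13) + r * sweepWork n Γ qf) r
      sweep↓ sweep = relax (≤-reflexive (lemma (r * (12 + n * 13)) (r * sweepWork n Γ qf))) ≤-refl
        (call↓ (2F ∷↓ (subset-small (unions Bs) ⊢
          call↓ (5F ∷↓ 0F ∷↓ []↓) (unions-cost ks Bs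
            (≤-trans (m≤n+m (1 + n * 4) (2 + size (codeInstance I) + S))
              (≤-trans (≤-reflexive (lemma′ (size (codeInstance I)) S n)) M-query)))
          ◂ 0F ∷↓ []↓)) sweep)
        where
        lemma : ∀ a b → 1 + (1 + (1 + (2 + (a + 3)) + 1) + (b + 7)) ≡ 16 + a + b
        lemma = solve-∀
        lemma′ : ∀ i s n → 2 + i + s + (1 + n * 4) ≡ 3 + i + s + n * 4
        lemma′ = solve-∀

      R = r * (12 + n * 13)
      W = r * sweepWork n Γ qf
      L = length ss

      r≤Q : ∀ h → r ≤ Q h
      r≤Q = ≤treeWork m r

      leaf≤ : ∀ h → 35 + R + W + qt ≤ T h
      leaf≤ h = ≤-trans (+-monoˡ-≤ qt (+-monoˡ-≤ W (+-monoˡ-≤ R (m≤m+n 35 6)))) (≤treeWork m w h)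

      inner≤ : ∀ h {l} → l ≤ m → 41 + R + W + l * T h ≤ T (suc h)
      inner≤ h l≤m = +-mono-≤ (m≤m+n (41 + R + W) qt) (*-monoˡ-≤ (T h) l≤m)

      children≤ : ∀ h → total Bs + suc h ≡ size* → ∀ {d} (branching : Branching (unions Bs) ks Bs d) →
                  length (Branching.children branching) ≤ m
      children≤ h eq branching = children-bounded {h} {Bs} eq _ (Branching.few branching)

      success-true : ∀ l a b q → 3 + (16 + a + b + (2 + (1 + (1 + (5 + q) + 3)))) + (l + 7) ≡
        35 + a + b + q + (l + 3)
      success-true = solve-∀

      success-false : ∀ l a b q → 3 + (16 + a + b + (2 + (1 + (1 + (5 + q) + (7 + (l + 3)))))) ≡
        35 + a + b + q + (l + 3)
      success-false = solve-∀

      failure-zero : ∀ l a b → 3 + (16 + a + b + (2 + (2 + (7 + (l + 3))))) ≡ 30 + a + b + (l + 3)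
      failure-zero = solve-∀

      failure-true : ∀ l a b c → 3 + (16 + a + b + (2 + (2 + (1 + (7 + (c + 3) + 3))))) + (l + 7) ≡
        41 + a + b + c + (l + 3)
      failure-true = solve-∀

      failure-false : ∀ l a b c → 3 + (16 + a + b + (2 + (2 + (1 + (7 + (c + 3) + (7 + (l + 3))))))) ≡
        41 + a + b + c + (l + 3)
      failure-false = solve-∀

      process : ∀ h → total Bs + h ≡ size* → SearchCost h ss →
        (∃[ d ] CallCost sweepFun (codeInstance I ∷ codeSubset (unions Bs) ∷ codeState ks Bs ∷ []) d
                  (r * sweepWork n Γ qf + 7) r × Outcome (unions Bs) ks Bs d) →
        SearchCost h (Bs ∷ ss)
      process h eq rest (d , sweep , outcome) with ≤-trans (size-outcome ks Bs S-state Γ≤ outcome) M-outcome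
      process h eq rest (nil , sweep , inj₁ record { code≡ = () }) | _
      process h eq rest (nil , sweep , inj₂ record { code≡ = () }) | _
      process h eq (β , rest , verdict) (cons _ _ , sweep ,
        inj₁ packing@(record { Js = Js ; code≡ = refl ; valid = valid })) | sm
        with judges Js (query-small Js)
      ... | d , inj₁ (refl , b≤𝔻) , thr↓ = true ,
        relax (charge (35 + R + W + qt) (T h) L (≤-slack (L * T h + 7) (success-true (L * T h) R W qt))
          (leaf≤ h))
          (≤-trans (≤-reflexive (+-identityʳ r)) (≤-trans (r≤Q h) (m≤m+n _ _)))
          (match-cons↓ refl (case-cons↓ sm (sweep↓ sweep) (match-cons↓ refl
            (case-cons↓ (bool-small true)
              (call↓ (query-small Js ⊢ cons↓ (var↓ 7F) (cons↓ (var↓ 3F) (var↓ 8F)) ◂ []↓) thr↓) true↓)))) ,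
        (Js , proj₁ valid , proj₂ valid , b≤𝔻)
      ... | d , inj₂ (refl , b≰𝔻) , thr↓ = β ,
        relax (charge (35 + R + W + qt) (T h) L (≤-reflexive (success-false (L * T h) R W qt)) (leaf≤ h))
          (+-monoˡ-≤ (L * Q h) (r≤Q h))
          (match-cons↓ refl (case-cons↓ sm (sweep↓ sweep) (match-cons↓ refl
            (case-nil↓
              (call↓ (query-small Js ⊢ cons↓ (var↓ 7F) (cons↓ (var↓ 3F) (var↓ 8F)) ◂ []↓) thr↓)
              (self↓ (6F ∷↓ 7F ∷↓ 8F ∷↓ 9F ∷↓ (suc 9F) ∷↓ 5F ∷↓ []↓) rest))))) ,
        extended β verdict
        where
        extended : ∀ β → Verdict ss β → Verdict (Bs ∷ ss) β
        extended true  solution = solution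
        extended false none As solution@(_ , _ , b≤𝔻) (here Bs⊑As) =
          b≰𝔻 (≤-trans b≤𝔻 (packing-dominates packing Bs⊑As solution))
        extended false none As solution (there covered) = none As solution covered
      process zero eq (β , rest , verdict) (cons _ _ , sweep ,
        inj₂ branching@(record { code≡ = refl })) | sm = β ,
        relax (charge (30 + R + W) (T 0) L (≤-reflexive (failure-zero (L * T 0) R W))
          (≤-trans (≤-trans (+-monoˡ-≤ W (+-monoˡ-≤ R (m≤m+n 30 5))) (m≤m+n _ qt)) (leaf≤ 0)))
          (+-monoˡ-≤ (L * Q 0) (r≤Q 0))
          (match-cons↓ refl (case-cons↓ sm (sweep↓ sweep) (match-nil↓ refl (match-nil↓ refl
            (self↓ (4F ∷↓ 5F ∷↓ 6F ∷↓ 7F ∷↓ 8F ∷↓ 3F ∷↓ []↓) rest))))) ,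
        extended β verdict
        where
        extended : ∀ β → Verdict ss β → Verdict (Bs ∷ ss) β
        extended true  solution = solution
        extended false none As solution (here Bs⊑As) = no-covering-child eq branching As solution Bs⊑As
        extended false none As solution (there covered) = none As solution covered
      process (suc h) eq (β , rest , verdict) (cons _ _ , sweep ,
        inj₂ branching@(record { code≡ = refl })) | sm
        with search-cost h (Branching.children branching)
               (Allᴸ.map (λ {C} eq′ → trans (cong (_+ h) eq′) (trans (sym (+-suc (total Bs) h)) eq))
                 (Branching.larger branching))
      ... | true , below , solution = true ,
        relax (charge (41 + R + W + length (Branching.children branching) * T h) (T (suc h)) L
            (≤-slack (L * T (suc h) + 7) (failure-true (L * T (suc h)) R W
              (length (Branching.children branching) * T h)))
            (inner≤ h (children≤ h eq branching)))
          (≤-trans (+-monoʳ-≤ r (≤-trans (≤-reflexive (+-identityʳ _))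
            (*-monoˡ-≤ (Q h) (children≤ h eq branching)))) (m≤m+n _ _))
          (match-cons↓ refl (case-cons↓ sm (sweep↓ sweep) (match-nil↓ refl (match-cons↓ refl
            (case-cons↓ (bool-small true) (self↓ (6F ∷↓ 7F ∷↓ 8F ∷↓ 9F ∷↓ 1F ∷↓ 3F ∷↓ []↓) below) true↓))))) ,
        solution
      ... | false , below , none = β ,
        relax (charge (41 + R + W + length (Branching.children branching) * T h) (T (suc h)) L
            (≤-reflexive (failure-false (L * T (suc h)) R W (length (Branching.children branching) * T h)))
            (inner≤ h (children≤ h eq branching)))
          (≤-trans (+-monoʳ-≤ r (+-monoˡ-≤ (L * Q (suc h)) (*-monoˡ-≤ (Q h) (children≤ h eq branching))))
            (≤-reflexive (sym (+-assoc r _ _))))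
          (match-cons↓ refl (case-cons↓ sm (sweep↓ sweep) (match-nil↓ refl (match-cons↓ refl
            (case-nil↓ (self↓ (6F ∷↓ 7F ∷↓ 8F ∷↓ 9F ∷↓ 1F ∷↓ 3F ∷↓ []↓) below)
              (self↓ (6F ∷↓ 7F ∷↓ 8F ∷↓ 9F ∷↓ (suc 9F) ∷↓ 5F ∷↓ []↓) rest)))))) ,
        extended β verdict
        where
        extended : ∀ β → Verdict ss β → Verdict (Bs ∷ ss) β
        extended true  solution = solution
        extended false none′ As solution@(feasible , sizes , _) (here Bs⊑As) =
          none As solution (Branching.covering branching As (feasible , sizes) Bs⊑As)
        extended false none′ As solution (there covered) = none′ As solution covered

  Correct-verdict : ∀ β → Verdict (Vec.replicate r ∅ ∷ []) β → Correct (Diverse 𝔻 Φ) x (codeBool β)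
  Correct-verdict true  solution = inj₁ (refl , solution)
  Correct-verdict false none     = inj₂ (refl , λ (As , solution) → none As solution (here (replicate-∅⊑ As)))

  diverse-cost : Answers → Judges → CallCost univ (codeInstance I ∷ []) (codeUniverse U) qu 0 →
                 ∃[ y ] CallCost diverseFun (code (Diverse 𝔻 Φ) x ∷ []) y
                   (treeWork m w (Vec.sum ks) + (Vec.sum ks * 7 + r * 21 + n * 12 + qu + 44))
                   (treeWork m r (Vec.sum ks)) ×
                 Correct (Diverse 𝔻 Φ) x y
  diverse-cost answers judges univ↓
    with search-cost answers judges (all≤max ks) (Vec.sum ks) (Vec.replicate r ∅ ∷ [])
           (cong (_+ Vec.sum ks) (total-replicate-∅ r) ∷ [])
  ... | β , search↓ , verdict = codeBool β ,
    relax (≤-reflexive (lemma (treeWork m w (Vec.sum ks)) (Vec.sum ks) r n qu)) (≤-reflexive (+-identityʳ _))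
      (match-cons↓ refl (match-cons↓ refl (call↓
        (2F ∷↓ 0F ∷↓ 1F ∷↓ (universe-small ⊢ call↓ (2F ∷↓ []↓) univ↓ ◂ []↓)) setup↓))) ,
    Correct-verdict β verdict
    where
    open ≤-Reasoning

    universe-small : Small (codeUniverse U)
    universe-small = begin
      size (codeUniverse U)                                   ≤⟨ m≤m+n _ (3 + (S + size (codeBinary b))) ⟩
      size (codeUniverse U) + (3 + (S + size (codeBinary b)))
        ≡⟨ rearrange (size (codeUniverse U)) S (size (codeBinary b)) ⟩
      3 + size (codeUniverse U) + S + size (codeBinary b)     ≤⟨ M-threshold ⟩
      M                                                       ∎
      where
      rearrange : ∀ u s b → u + (3 + (s + b)) ≡ 3 + u + s + b
      rearrange = solve-∀

    5+S≤M : 5 + S ≤ M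
    5+S≤M = ≤-trans (m≤m+n (5 + S) _) M-outcome

    ks-small : Small (codeVec codeUnary ks)
    ks-small = ≤-trans (≤-trans (≤-trans (m≤m+n _ _) S-state) (m≤n+m S 5)) 5+S≤M

    root-small : Small (cons (codeState ks (Vec.replicate r ∅)) nil)
    root-small = begin
      suc (size (codeState ks (Vec.replicate r ∅)) + 1)
        ≤⟨ s≤s (+-monoˡ-≤ 1 (≤-trans (size-codeState ks (Vec.replicate r ∅)) S-state)) ⟩
      suc (S + 1)                                   ≡⟨ cong suc (+-comm S 1) ⟩
      2 + S                                         ≤⟨ +-monoˡ-≤ S (m≤m+n 2 3) ⟩
      5 + S                                         ≤⟨ 5+S≤M ⟩
      M                                             ∎

    startWork setupWork : ℕ
    startWork = 1 + (4 + (2 + (Vec.sum ks * 7 + r * 9 + 3) + (1 + (1 + (3 + (r * 12 + 3)) + 1) + 0)) +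
      (treeWork m w (Vec.sum ks) + 0 + 3))
    setupWork = 1 + (4 + (1 + (3 + (n * 12 + 3)) + 0) + startWork)

    start↓ : CallCost startFun (codeInstance I ∷ codeVec codeUnary ks ∷ codeBinary b ∷
               codeUniverse U ∷ codeSubset {n} ∅ ∷ [])
               (codeBool β)
               startWork (treeWork m r (Vec.sum ks) + 0)
    start↓ = call↓ (0F ∷↓ 3F ∷↓ 2F ∷↓ 4F ∷↓ (≤-trans (sum-size ks) ks-small ⊢ call↓ (1F ∷↓ []↓)
      (sum-cost ks ks-small) ◂
      (root-small ⊢ cons↓ (call↓ (4F ∷↓ (small-nil ⊢ nil↓ ◂ 1F ∷↓ []↓))
        (subst₂ (λ d l → CallCost rootFun (codeSubset {n} ∅ ∷ nil ∷ codeVec codeUnary ks ∷ []) d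
          (l * 12 + 3) 0) (code-root ks) (length-toList ks)
          (map-cost (λ k → k) codeUnary (λ k → cons (codeUnary k) (codeSubset {n} ∅))
            (λ _ → relax (m≤m+n 3 2) z≤n (cons↓ (var↓ 0F) (var↓ 2F))) (toList ks)))) nil↓ ◂ []↓))) search↓

    setup↓ : CallCost setupFun (codeInstance I ∷ codeVec codeUnary ks ∷ codeBinary b ∷ codeUniverse U ∷ [])
      (codeBool β)
               setupWork (treeWork m r (Vec.sum ks) + 0)
    setup↓ = call↓ (0F ∷↓ 1F ∷↓ 2F ∷↓ 3F ∷↓ (subset-small ∅ ⊢ call↓
      (small-nil ⊢ nil↓ ◂ (small-nil ⊢ nil↓ ◂ 3F ∷↓ []↓))
      (subst₂ (λ d l → CallCost emptiesFun (nil ∷ nil ∷ codeUniverse U ∷ []) d (l * 12 + 3) 0)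
        (code-∅ (elements U)) (length-toList (elements U))
        (map-cost (λ _ → false) (λ d → d) codeBool (λ _ → relax (m≤m+n 1 4) z≤n nil↓)
          (toList (elements U)))) ◂ []↓)) start↓

    lemma : ∀ t s r n u →
      5 + (3 + (2 + u + 0) + (1 + (4 + (1 + (3 + (n * 12 + 3)) + 0) +
        (1 + (4 + (2 + (s * 7 + r * 9 + 3) + (1 + (1 + (3 + (r * 12 + 3)) + 1) + 0)) + (t + 0 + 3)))))) ≡
      t + (s * 7 + r * 21 + n * 12 + u + 44)
    lemma = solve-∀

-- Running plain programs inside oracle programs

mutual
  liftTerm : ∀ {Ω m n} → Term ⊥ m n → Term Ω m n
  liftTerm (var i)        = var i
  liftTerm nil            = nil
  liftTerm (cons e₁ e₂)   = cons (liftTerm e₁) (liftTerm e₂)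
  liftTerm (case e e₁ e₂) = case (liftTerm e) (liftTerm e₁) (liftTerm e₂)
  liftTerm (call f es)    = call (liftFunction f) (liftTerms es)
  liftTerm (self es)      = self (liftTerms es)

  liftTerms : ∀ {Ω m n l} → Vec (Term ⊥ m n) l → Vec (Term Ω m n) l
  liftTerms []       = []
  liftTerms (e ∷ es) = liftTerm e ∷ liftTerms es

  liftFunction : ∀ {Ω l} → Function ⊥ l → Function Ω l
  liftFunction (fun body) = fun (liftTerm body)

module _ {Ω : Set} (O₀ : ⊥ → Data → Data) (O : Ω → Data → Data) where
  mutual
    -- With no oracle names there is no `ask`, so every trace of the lifted run is empty.
    liftEval : ∀ {m n} {body : Term ⊥ m m} {ρ : Vec Data n} {e d t q} →
               Eval O₀ body ρ e d t q → Eval O (liftTerm body) ρ (liftTerm e) d t []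
    liftEval (var i)         = var i
    liftEval nil             = nil
    liftEval (cons x y)      = cons (liftEval x) (liftEval y)
    liftEval (case-nil x y)  = case-nil (liftEval x) (liftEval y)
    liftEval (case-cons x y) = case-cons (liftEval x) (liftEval y)
    liftEval (call x y)      = call (liftEvals x) (liftEval y)
    liftEval (self x y)      = self (liftEvals x) (liftEval y)

    liftEvals : ∀ {m n l} {body : Term ⊥ m m} {ρ : Vec Data n} {es : Vec (Term ⊥ m n) l} {ds t q} →
                Evals O₀ body ρ es ds t q → Evals O (liftTerm body) ρ (liftTerms es) ds t []
    liftEvals []       = []
    liftEvals (x ∷ xs) = liftEval x ∷ liftEvals xs

module _ {Ω : Set} (O : Ω → Data → Data) (metering : Metering Ω) (M : ℕ) (M>0 : 1 ≤ M) where
  open Calculus O metering M M>0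

  -- A running time of at most c is charged as c multiples of `M`. This loses a factor `M`, which is
  -- harmless because `M` is polynomial in the input length.
  lift-cost : ∀ {p x y t c j} → RunPlain p x y t → t ≤ c → CallCost (liftFunction p) (x ∷ []) y c j
  lift-cost {fun body} {c = c} (_ , ev) t≤c .run _ = _ , _ , liftEval _ O ev ,
    ≤-trans t≤c (m≤m*n c M {{>-nonZero M>0}}) , asks-≤ z≤n asks-[]
    where open Metering metering

-- Computable functions and the time bound

mulFun : Function ⊥ 2
mulFun = fun (case v0 nil (call addFun (v3 ∷ self (v1 ∷ v3 ∷ []) ∷ [])))

-- The exponent is the first argument.
powFun : Function ⊥ 2
powFun = fun (case v0 trueᵗ (call mulFun (v3 ∷ self (v1 ∷ v3 ∷ []) ∷ [])))

Terminates : ∀ {l} → Function ⊥ l → Vec Data l → Data → Set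
Terminates (fun body) ds d = ∃[ t ] ∃[ q ] Eval (λ ()) body ds body d t q

run⇒terminates : ∀ p {x y} → (∃[ t ] RunPlain p x y t) → Terminates p (x ∷ []) y
run⇒terminates (fun _) ev = ev

call-terminates : ∀ {m n l} {body : Term ⊥ m m} {ρ : Vec Data n} {f : Function ⊥ l} {es ds d t q} →
                  Evals (λ ()) body ρ es ds t q → Terminates f ds d →
                  ∃[ t ] ∃[ q ] Eval (λ ()) body ρ (call f es) d t q
call-terminates {f = fun _} args (_ , _ , ev) = _ , _ , call args ev

add-terminates : ∀ m n → Terminates addFun (codeUnary m ∷ codeUnary n ∷ []) (codeUnary (m + n))
add-terminates zero    n = _ , _ , case-nil (var _) (var _)
add-terminates (suc m) n = let (_ , _ , ev) = add-terminates m n in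
  _ , _ , case-cons (var _) (cons nil (self (var _ ∷ var _ ∷ []) ev))

mul-terminates : ∀ m n → Terminates mulFun (codeUnary m ∷ codeUnary n ∷ []) (codeUnary (m * n))
mul-terminates zero    n = _ , _ , case-nil (var _) nil
mul-terminates (suc m) n =
  let (_ , _ , ev)  = mul-terminates m n
      (_ , _ , ev′) = add-terminates n (m * n)
  in _ , _ , case-cons (var _) (call (var _ ∷ self (var _ ∷ var _ ∷ []) ev ∷ []) ev′)

pow-terminates : ∀ m n → Terminates powFun (codeUnary m ∷ codeUnary n ∷ []) (codeUnary (n ^ m))
pow-terminates zero    n = _ , _ , case-nil (var _) (cons nil nil)
pow-terminates (suc m) n =
  let (_ , _ , ev)  = pow-terminates m n
      (_ , _ , ev′) = mul-terminates n (n ^ m)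
  in _ , _ , case-cons (var _) (call (var _ ∷ self (var _ ∷ var _ ∷ []) ev ∷ []) ev′)

computable-∘₂ : ∀ (op : ℕ → ℕ → ℕ) f →
                (∀ m n → Terminates f (codeUnary m ∷ codeUnary n ∷ []) (codeUnary (op m n))) →
                ∀ {g h} → Computable g → Computable h → Computable (λ n → op (g n) (h n))
computable-∘₂ op f f↓ {g} {h} (p , p↓) (p′ , p′↓) =
  fun (call f (call p (v0 ∷ []) ∷ call p′ (v0 ∷ []) ∷ [])) , λ n →
    let (_ , _ , ev)  = call-terminates (var _ ∷ []) (run⇒terminates p (p↓ n))
        (_ , _ , ev′) = call-terminates (var _ ∷ []) (run⇒terminates p′ (p′↓ n))
    in call-terminates (ev ∷ ev′ ∷ []) (f↓ (g n) (h n))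

computable-+ : ∀ {g h} → Computable g → Computable h → Computable (λ n → g n + h n)
computable-+ = computable-∘₂ _+_ addFun add-terminates

computable-* : ∀ {g h} → Computable g → Computable h → Computable (λ n → g n * h n)
computable-* = computable-∘₂ _*_ mulFun mul-terminates

computable-^ : ∀ {g h} → Computable g → Computable h → Computable (λ n → g n ^ h n)
computable-^ g h = computable-∘₂ (λ m n → n ^ m) powFun pow-terminates h g

computable-∘ : ∀ {g h} → Computable g → Computable h → Computable (λ n → g (h n))
computable-∘ {h = h} (p , p↓) (p′ , p′↓) = fun (call p (call p′ (v0 ∷ []) ∷ [])) , λ n →
  let (_ , _ , ev) = call-terminates (var _ ∷ []) (run⇒terminates p′ (p′↓ n))
  in call-terminates (ev ∷ []) (run⇒terminates p (p↓ (h n)))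

computable-id : Computable (λ n → n)
computable-id = fun v0 , λ n → _ , _ , var _

computable-const : ∀ c → Computable (λ _ → c)
computable-const c = fun (numeral c) , λ n → let (_ , _ , ev) = numeral↓ c in _ , _ , ev
  where
  numeral : ∀ {m n} → ℕ → Term ⊥ m n
  numeral zero    = nil
  numeral (suc c) = cons nil (numeral c)

  numeral↓ : ∀ {m n} {body : Term ⊥ m m} {ρ : Vec Data n} c →
             ∃[ t ] ∃[ q ] Eval (λ ()) body ρ (numeral c) (codeUnary c) t q
  numeral↓ zero    = _ , _ , nil
  numeral↓ (suc c) = let (_ , _ , ev) = numeral↓ c in _ , _ , cons nil ev

-- A computable majorant at all smaller arguments. The time bound of a fixed-parameter solver need
-- not be monotone, while the parameters of the queries are known only up to an upper bound.
sumUpTo : (ℕ → ℕ) → ℕ → ℕ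
sumUpTo f zero    = f zero
sumUpTo f (suc n) = f (suc n) + sumUpTo f n

≤sumUpTo : ∀ f {m n} → m ≤′ n → f m ≤ sumUpTo f n
≤sumUpTo f {zero}  ≤′-refl = ≤-refl
≤sumUpTo f {suc m} ≤′-refl = m≤m+n (f (suc m)) (sumUpTo f m)
≤sumUpTo f (≤′-step m≤n)   = ≤-trans (≤sumUpTo f m≤n) (m≤n+m _ (f _))

computable-sumUpTo : ∀ {f} → Computable f → Computable (sumUpTo f)
computable-sumUpTo {f} (p , p↓) =
  fun (case v0 (call p (v0 ∷ [])) (call addFun (call p (v2 ∷ []) ∷ self (v1 ∷ []) ∷ []))) , loop
  where
  loop : ∀ n → _
  loop zero =
    let (_ , _ , ev) = call-terminates (var _ ∷ []) (run⇒terminates p (p↓ zero))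
    in _ , _ , case-nil (var _) ev
  loop (suc n) =
    let (_ , _ , ev)  = call-terminates (var _ ∷ []) (run⇒terminates p (p↓ (suc n)))
        (_ , _ , ev′) = loop n
        (_ , _ , ev″) = add-terminates (f (suc n)) (sumUpTo f n)
    in _ , _ , case-cons (var _) (call (ev ∷ self (var _ ∷ []) ev′ ∷ []) ev″)

-- Closure properties of bounds of the form f(κ) · N^c

module Tractability (N κ : DiverseInput → ℕ) (N>0 : ∀ x → 1 ≤ N x) where

  Tractable : (DiverseInput → ℕ) → Set
  Tractable g = ∃[ f ] ∃[ c ] Computable f × (∀ x → g x ≤ f (κ x) * N x ^ c)

  ≤-^ : ∀ x c → 1 ≤ N x ^ c
  ≤-^ x c = m^n>0 (N x) {{>-nonZero (N>0 x)}} c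

  tractable-param : ∀ {f} → Computable f → Tractable (λ x → f (κ x))
  tractable-param computable = _ , 0 , computable , λ x → ≤-reflexive (sym (*-identityʳ _))

  tractable-const : ∀ c → Tractable (λ _ → c)
  tractable-const c = tractable-param (computable-const c)

  tractable-size : Tractable N
  tractable-size = _ , 1 , computable-const 1 , λ x → ≤-reflexive
    (trans (sym (^-identityʳ (N x))) (sym (*-identityˡ _)))

  tractable-* : ∀ {g h} → Tractable g → Tractable h → Tractable (λ x → g x * h x)
  tractable-* {g} {h} (f , c , computable , g≤) (f′ , c′ , computable′ , h≤) =
    _ , c + c′ , computable-* computable computable′ , λ x → begin
      g x * h x                                             ≤⟨ *-mono-≤ (g≤ x) (h≤ x) ⟩
      f (κ x) * N x ^ c * (f′ (κ x) * N x ^ c′)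
        ≡⟨ lemma (f (κ x)) (N x ^ c) (f′ (κ x)) (N x ^ c′) ⟩
      f (κ x) * f′ (κ x) * (N x ^ c * N x ^ c′)
        ≡⟨ cong (f (κ x) * f′ (κ x) *_) (^-distribˡ-+-* (N x) c c′) ⟨
      f (κ x) * f′ (κ x) * N x ^ (c + c′)                   ∎
    where
    open ≤-Reasoning
    lemma : ∀ a b c d → a * b * (c * d) ≡ a * c * (b * d)
    lemma = solve-∀

  -- Both terms are raised to the common exponent c + c′, which is possible because N ≥ 1.
  tractable-+ : ∀ {g h} → Tractable g → Tractable h → Tractable (λ x → g x + h x)
  tractable-+ {g} {h} (f , c , computable , g≤) (f′ , c′ , computable′ , h≤) =
    _ , c + c′ , computable-+ computable computable′ , λ x → begin
      g x + h x
        ≤⟨ +-mono-≤ (g≤ x) (h≤ x) ⟩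
      f (κ x) * N x ^ c + f′ (κ x) * N x ^ c′
        ≤⟨ +-mono-≤ (*-monoʳ-≤ (f (κ x)) (m≤m*n (N x ^ c) (N x ^ c′) {{>-nonZero (≤-^ x c′)}}))
                    (*-monoʳ-≤ (f′ (κ x)) (m≤n*m (N x ^ c′) (N x ^ c) {{>-nonZero (≤-^ x c)}})) ⟩
      f (κ x) * (N x ^ c * N x ^ c′) + f′ (κ x) * (N x ^ c * N x ^ c′)
        ≡⟨ *-distribʳ-+ (N x ^ c * N x ^ c′) (f (κ x)) (f′ (κ x)) ⟨
      (f (κ x) + f′ (κ x)) * (N x ^ c * N x ^ c′)
        ≡⟨ cong ((f (κ x) + f′ (κ x)) *_) (^-distribˡ-+-* (N x) c c′) ⟨
      (f (κ x) + f′ (κ x)) * N x ^ (c + c′) ∎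
    where open ≤-Reasoning

  tractable-^ : ∀ {g} → Tractable g → ∀ c → Tractable (λ x → g x ^ c)
  tractable-^ g zero    = tractable-const 1
  tractable-^ g (suc c) = tractable-* g (tractable-^ g c)

-- Query counting, output sizes and monotonicity

forbiddenQueries-++ : ∀ p q → forbiddenQueries (p ++ q) ≡ forbiddenQueries p ++ forbiddenQueries q
forbiddenQueries-++ []                    q = refl
forbiddenQueries-++ ((forbidden , d) ∷ p) q = cong (d ∷_) (forbiddenQueries-++ p q)
forbiddenQueries-++ ((threshold , d) ∷ p) q = forbiddenQueries-++ p q

countingForbidden : (Data → Set) → Metering Oracle
countingForbidden P = record
  { Asks    = λ j q → length (forbiddenQueries q) ≤ j × Allᴸ P (forbiddenQueries q)
  ; asks-[] = z≤n , []
  ; asks-++ = λ {i} {j} {p} {q} (p≤i , Pp) (q≤j , Pq) →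
      ≤-trans (≤-reflexive (trans (cong length (forbiddenQueries-++ p q)) (length-++ (forbiddenQueries p))))
              (+-mono-≤ p≤i q≤j) ,
      subst (Allᴸ P) (sym (forbiddenQueries-++ p q)) (Allᴸ.++⁺ Pp Pq)
  ; asks-≤  = λ i≤j (q≤i , Pq) → ≤-trans q≤i i≤j , Pq
  }

unmetered : ∀ {Ω} → Metering Ω
unmetered = record { Asks = λ _ _ → ⊤ ; asks-[] = tt ; asks-++ = λ _ _ → tt ; asks-≤ = λ _ _ → tt }

-- Applied to the program that lists the universe, this makes the universe polynomially large.
size≤cost : ∀ {Ω} {O : Ω → Data → Data} {m n} {body : Term Ω m m} {ρ : Vec Data n} {e d t q} →
            Eval O body ρ e d t q → size d ≤ t
size≤cost (var i)         = ≤-refl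
size≤cost nil             = ≤-refl
size≤cost (cons x y)      = s≤s (+-mono-≤ (size≤cost x) (size≤cost y))
size≤cost (case-nil x y)  = ≤-trans (size≤cost y) (m≤n+m _ (suc _))
size≤cost (case-cons x y) = ≤-trans (size≤cost y) (m≤n+m _ (suc _))
size≤cost (call x y)      = ≤-trans (size≤cost y) (m≤n+m _ (suc _))
size≤cost (self x y)      = ≤-trans (size≤cost y) (m≤n+m _ (suc _))
size≤cost (ask x)         = m≤n+m _ (suc _)

size≤runtime : ∀ p {x y t} → RunPlain p x y t → size y ≤ t
size≤runtime (fun _) (_ , ev) = size≤cost ev

nodeWork-mono : ∀ {n n′ r r′ Γ Γ′} qf qt → n ≤ n′ → r ≤ r′ → Γ ≤ Γ′ →
                nodeWork n r Γ qf qt ≤ nodeWork n′ r′ Γ′ qf qt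
nodeWork-mono qf qt n≤ r≤ Γ≤ = +-monoˡ-≤ qt (+-mono-≤
  (+-monoʳ-≤ 41 (*-mono-≤ r≤ (+-monoʳ-≤ 12 (*-monoˡ-≤ 13 n≤))))
  (*-mono-≤ r≤ (+-monoʳ-≤ qf (+-mono-≤ (+-mono-≤ (+-monoʳ-≤ 40 (*-monoˡ-≤ 38 n≤))
    (*-mono-≤ n≤ (+-monoʳ-≤ 21 (*-monoˡ-≤ 12 n≤)))) (*-monoˡ-≤ 12 Γ≤)))))

^-mono : ∀ {a b c d} → a ≤ b → c ≤ d → 1 ≤ b → a ^ c ≤ b ^ d
^-mono {b = b} {c = c} a≤b c≤d b>0 = ≤-trans (^-monoˡ-≤ c a≤b) (^-monoʳ-≤ b {{>-nonZero b>0}} c≤d)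

-- For s > 0 the base on the left is exactly 2s. For s = 0 the truncated subtraction leaves 1 ^ 0,
-- and the convention 0 ^ 0 = 1 covers p = 0.
branching^depth : ∀ s p → s ≤ p → (1 + (s + s ∸ 1)) ^ s ≤ (2 * p) ^ p
branching^depth zero    zero    _   = ≤-refl
branching^depth zero    (suc p) _   = m^n>0 (2 * suc p) (suc p)
branching^depth (suc s) (suc p) s≤p = ^-mono
  (≤-trans (+-mono-≤ s≤p s≤p) (≤-reflexive (cong (suc p +_) (sym (+-identityʳ (suc p)))))) s≤p (s≤s z≤n)

-- Concrete polynomial bounds

module Assembly (Φ : ImplicitSetSystem) (𝔻 : DiversityFunction) (a e : ℕ) where

  -- `V` bounds the coded universe and `S` a coded state. Each summand of `M` meets one size
  -- requirement of `Adequate`; the last admits the input.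
  N V S M : DiverseInput → ℕ
  N x = size (code (Diverse 𝔻 Φ) x)
  V x = a * N x ^ e
  S x = N x + N x * (2 + V x * 4)
  M x = 1 + V x * (2 + V x * 4) + (3 + N x + S x + V x * 4) + (3 + V x + S x + N x) +
        (5 + S x + (N x + N x) * (1 + S x)) + N x

  κ = diverseParam

  -- A bound on kr, and so on Σ kᵢ, that depends on the parameter k + r alone.
  κ² : ℕ → ℕ
  κ² κ = κ * κ

  bound : (qf qt : DiverseInput → ℕ) → DiverseInput → ℕ
  bound qf qt x =
    (nodeWork (V x) (N x) (N x + N x) (qf x) (qt x) * (1 + (κ² (κ x) + κ² (κ x))) ^ κ² (κ x) +
      (N x * 7 + N x * 21 + V x * 12 + V x + 44)) * M x

  open Tractability N κ (λ x → s≤s z≤n) public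

  infixl 6 _⊕_
  infixl 7 _⊗_
  _⊕_ = tractable-+
  _⊗_ = tractable-*
  # = tractable-const
  `N = tractable-size

  tractable-V : Tractable V
  tractable-V = # a ⊗ tractable-^ `N e

  tractable-S : Tractable S
  tractable-S = `N ⊕ `N ⊗ (# 2 ⊕ tractable-V ⊗ # 4)

  tractable-M : Tractable M
  tractable-M = # 1 ⊕ tractable-V ⊗ (# 2 ⊕ tractable-V ⊗ # 4) ⊕ (# 3 ⊕ `N ⊕ tractable-S ⊕ tractable-V ⊗ # 4) ⊕
    (# 3 ⊕ tractable-V ⊕ tractable-S ⊕ `N) ⊕ (# 5 ⊕ tractable-S ⊕ (`N ⊕ `N) ⊗ (# 1 ⊕ tractable-S)) ⊕ `N

  computable-κ² : Computable κ²
  computable-κ² = computable-* computable-id computable-id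

  tractable-bound : ∀ {qf qt} → Tractable qf → Tractable qt → Tractable (bound qf qt)
  tractable-bound qf qt =
    -- Follows `bound` operation by operation. The power depends on the parameter only; apart from
    -- `qf` and `qt` everything else is polynomial in N.
    ((# 41 ⊕ `N ⊗ (# 12 ⊕ tractable-V ⊗ # 13) ⊕
        `N ⊗ (qf ⊕ (# 40 ⊕ tractable-V ⊗ # 38 ⊕ tractable-V ⊗ (# 21 ⊕ tractable-V ⊗ # 12) ⊕
          (`N ⊕ `N) ⊗ # 12)) ⊕ qt) ⊗
      tractable-param (computable-^ (computable-+ (computable-const 1)
        (computable-+ computable-κ² computable-κ²)) computable-κ²) ⊕
      (`N ⊗ # 7 ⊕ `N ⊗ # 21 ⊕ tractable-V ⊗ # 12 ⊕ tractable-V ⊕ # 44)) ⊗ tractable-M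

  module Estimates (universe-cost : ∀ I → size (codeUniverse (universe (Φ I))) ≤
                                    a * size (codeInstance I) ^ e)
                   (x : DiverseInput) where
    open DiverseInput x
    open ≤-Reasoning

    private
      n = ∣U∣ Φ I
      s = Vec.sum ks

    I≤N : size (codeInstance I) ≤ N x
    I≤N = ≤-trans (m≤m+n _ _) (n≤1+n _)

    ks≤N : size (codeVec codeUnary ks) ≤ N x
    ks≤N = ≤-trans (m≤m+n _ _) (≤-trans (n≤1+n _) (≤-trans (m≤n+m _ (size (codeInstance I))) (n≤1+n _)))

    b≤N : size (codeBinary b) ≤ N x
    b≤N = ≤-trans (m≤n+m _ (size (codeVec codeUnary ks)))
      (≤-trans (n≤1+n _) (≤-trans (m≤n+m _ (size (codeInstance I))) (n≤1+n _)))

    r≤N : r ≤ N x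
    r≤N = ≤-trans (length≤size codeUnary ks) ks≤N

    s≤N : s ≤ N x
    s≤N = begin
      s                    ≤⟨ m≤m*n s 2 ⟩
      s * 2                ≤⟨ n≤1+n _ ⟩
      1 + s * 2            ≡⟨ size-codeUnary s ⟨
      size (codeUnary s)   ≤⟨ sum-size ks ⟩
      size (codeVec codeUnary ks) ≤⟨ ks≤N ⟩
      N x                  ∎

    U≤V : size (codeUniverse (universe (Φ I))) ≤ V x
    U≤V = ≤-trans (universe-cost I) (*-monoʳ-≤ a (^-monoˡ-≤ e I≤N))

    n≤V : n ≤ V x
    n≤V = ≤-trans (length≤size (λ d → d) (elements (universe (Φ I)))) U≤V

    S-state : size (codeVec codeUnary ks) + r * (2 + n * 4) ≤ S x
    S-state = +-mono-≤ ks≤N (*-mono-≤ r≤N (+-monoʳ-≤ 2 (*-monoˡ-≤ 4 n≤V)))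

    M-extend : 1 + n * (2 + n * 4) ≤ M x
    M-extend = begin
      1 + n * (2 + n * 4)         ≤⟨ s≤s (*-mono-≤ n≤V (+-monoʳ-≤ 2 (*-monoˡ-≤ 4 n≤V))) ⟩
      1 + V x * (2 + V x * 4)
        ≤⟨ ≤-trans (m≤m+n _ _) (≤-trans (m≤m+n _ _) (≤-trans (m≤m+n _ _) (m≤m+n _ _))) ⟩
      M x                         ∎

    M-query : 3 + size (codeInstance I) + S x + n * 4 ≤ M x
    M-query = begin
      3 + size (codeInstance I) + S x + n * 4
        ≤⟨ +-mono-≤ (+-monoˡ-≤ (S x) (+-monoʳ-≤ 3 I≤N)) (*-monoˡ-≤ 4 n≤V) ⟩
      3 + N x + S x + V x * 4
        ≤⟨ ≤-trans (m≤n+m _ (1 + V x * (2 + V x * 4)))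
          (≤-trans (m≤m+n _ _) (≤-trans (m≤m+n _ _) (m≤m+n _ _))) ⟩
      M x                                     ∎

    M-threshold : 3 + size (codeUniverse (universe (Φ I))) + S x + size (codeBinary b) ≤ M x
    M-threshold = begin
      3 + size (codeUniverse (universe (Φ I))) + S x + size (codeBinary b)
        ≤⟨ +-mono-≤ (+-monoˡ-≤ (S x) (+-monoʳ-≤ 3 U≤V)) b≤N ⟩
      3 + V x + S x + N x
        ≤⟨ ≤-trans (m≤n+m _ (1 + V x * (2 + V x * 4) + (3 + N x + S x + V x * 4)))
          (≤-trans (m≤m+n _ _) (m≤m+n _ _)) ⟩
      M x ∎

    M-outcome : 5 + S x + (s + s) * (1 + S x) ≤ M x
    M-outcome = begin
      5 + S x + (s + s) * (1 + S x)     ≤⟨ +-monoʳ-≤ (5 + S x) (*-monoˡ-≤ (1 + S x) (+-mono-≤ s≤N s≤N)) ⟩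
      5 + S x + (N x + N x) * (1 + S x)
        ≤⟨ ≤-trans (m≤n+m _ (1 + V x * (2 + V x * 4) + (3 + N x + S x + V x * 4) + (3 + V x + S x + N x)))
          (m≤m+n _ (N x)) ⟩
      M x                               ∎

    input-small : N x ≤ M x
    input-small = m≤n+m (N x) (1 + V x * (2 + V x * 4) + (3 + N x + S x + V x * 4) + (3 + V x + S x + N x) +
      (5 + S x + (N x + N x) * (1 + S x)))

    s≤kr : s ≤ k * r
    s≤kr = sum≤max*length ks (all≤max ks)

    kr≤κ² : k * r ≤ κ² (κ x)
    kr≤κ² = *-mono-≤ (m≤m+n k r) (m≤n+m r k)

    s≤κ² : s ≤ κ² (κ x)
    s≤κ² = ≤-trans s≤kr kr≤κ²

    k+2s≤ : k + (s + s) ≤ k + 2 * k * r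
    k+2s≤ = +-monoʳ-≤ k (≤-trans (+-mono-≤ s≤kr s≤kr)
      (≤-reflexive (trans (cong (k * r +_) (sym (+-identityʳ (k * r)))) (sym (*-assoc 2 k r)))))

    m : ℕ
    m = s + s ∸ 1

    m-children : s + s ≤ 1 + m
    m-children = m≤n+m∸n (s + s) 1

    adequate : Adequate Φ x (M x) (S x) m
    adequate = record
      { S-state     = S-state
      ; m-children  = m-children
      ; M-extend    = M-extend
      ; M-query     = M-query
      ; M-threshold = M-threshold
      ; M-outcome   = M-outcome
      }

    calls≤ : treeWork m r s ≤ (2 * k * r) ^ (k * r) * r
    calls≤ = begin
      treeWork m r s              ≤⟨ treeWork≤ m r s ⟩
      r * (1 + m) ^ s             ≤⟨ *-monoʳ-≤ r (branching^depth s (k * r) s≤kr) ⟩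
      r * (2 * (k * r)) ^ (k * r) ≡⟨ *-comm r _ ⟩
      (2 * (k * r)) ^ (k * r) * r ≡⟨ cong (λ p → p ^ (k * r) * r) (*-assoc 2 k r) ⟨
      (2 * k * r) ^ (k * r) * r   ∎

    work≤ : ∀ (qf qt : DiverseInput → ℕ) →
            (treeWork m (nodeWork n r (s + s) (qf x) (qt x)) s + (s * 7 + r * 21 + n * 12 + V x + 44)) * M x ≤
            bound qf qt x
    work≤ qf qt = *-monoˡ-≤ (M x) (+-mono-≤
      (≤-trans (treeWork≤ m _ s) (*-mono-≤
        (nodeWork-mono (qf x) (qt x) n≤V r≤N (+-mono-≤ s≤N s≤N))
        (^-mono (s≤s (≤-trans (m∸n≤m (s + s) 1) (+-mono-≤ s≤κ² s≤κ²))) s≤κ² (s≤s z≤n))))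
      (+-monoˡ-≤ 44 (+-monoˡ-≤ (V x) (+-mono-≤ (+-mono-≤ (*-monoˡ-≤ 7 s≤N) (*-monoˡ-≤ 21 r≤N))
        (*-monoˡ-≤ 12 n≤V)))))

-- The oracle algorithm and fixed-parameter tractability

module Reduction (Φ : ImplicitSetSystem) (universe-polyTime : PolyTime (UniverseProblem Φ))
                 (𝔻 : DiversityFunction) (consistent : ConsistentlyDiverse 𝔻) where

  private
    a = proj₁ (proj₂ universe-polyTime)
    e = proj₁ (proj₂ (proj₂ universe-polyTime))

  univ : Program ⊥
  univ = proj₁ universe-polyTime

  univ-runs : ∀ I → ∃[ t ] RunPlain univ (codeInstance I) (codeUniverse (universe (Φ I))) t ×
              t ≤ a * size (codeInstance I) ^ e
  univ-runs I with proj₂ (proj₂ (proj₂ universe-polyTime)) I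
  ... | _ , t , run , refl , t≤ = t , run , t≤

  universe-cost : ∀ I → size (codeUniverse (universe (Φ I))) ≤ a * size (codeInstance I) ^ e
  universe-cost I = let (t , run , t≤) = univ-runs I in ≤-trans (size≤runtime univ run) t≤

  open Assembly Φ 𝔻 a e public

  module _ {Ω : Set} (forb thr : Function Ω 1) where

    algorithm : Program Ω
    algorithm = Algorithm.diverseFun forb thr (liftFunction univ)

    module Run (O : Ω → Data → Data) (metering : Metering Ω) (x : DiverseInput)
               (qf qt : DiverseInput → ℕ) where
      open DiverseInput x
      open Metering metering
      open Estimates universe-cost x public
      open Calculus O metering (M x) (s≤s z≤n) public
      open Sweep O metering Φ I forb thr (liftFunction univ) (M x) (S x) (Vec.sum ks + Vec.sum ks) k (qf x)
        (s≤s z≤n)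
        M-extend M-query M-outcome public using (Answers; forbiddenInput)
      open Search O metering Φ 𝔻 consistent x forb thr (liftFunction univ) (M x) (S x) m (qf x) (qt x) (V x)
        (s≤s z≤n)
        adequate public using (Judges; bool-small; diverse-cost)

      algorithm-runs : Answers → Judges →
        ∃[ y ] ∃[ t ] ∃[ q ] Defs.Run O algorithm (code (Diverse 𝔻 Φ) x) y t q × Correct (Diverse 𝔻 Φ) x y ×
          Asks (treeWork m r (Vec.sum ks)) q × t ≤ bound qf qt x
      algorithm-runs answers judges =
        let (t₀ , run₀ , t₀≤)       = univ-runs I
            (y , cost , correct)    = diverse-cost answers judges
              (lift-cost O metering (M x) (s≤s z≤n) run₀ (≤-trans t₀≤ (*-monoʳ-≤ a (^-monoˡ-≤ e I≤N))))
            (t , q , ev , t≤ , asks) = cost .run (input-small ∷ [])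
        in y , t , q , ev , correct , asks , ≤-trans t≤ (work≤ qf qt)

  oracleAlgorithm : OracleAlgorithm 𝔻 Φ
  oracleAlgorithm =
    -- An oracle call costs at most 3M: the rule itself, the reading of the query and the answer.
    let (f , c , computable , bound≤) = tractable-bound (tractable-const 3) (tractable-const 3)
    in algorithm forb thr , f , c , computable , λ O solves x →
      let (y , t , q , run , correct , (calls , params) , t≤) =
            algorithm-runs O x (answers O solves x) (judges O solves x)
      in y , t , q , run , correct , ≤-trans calls (calls≤ O x) , params , ≤-trans t≤ (bound≤ x)
    where
    forb thr : Function Oracle 1
    forb = fun (ask forbidden v0)
    thr = fun (ask threshold v0)

    Bounded : DiverseInput → Data → Set
    Bounded x d = let open DiverseInput x in
      Σ[ z ∈ ForbiddenInput Φ ] d ≡ code (ForbiddenSubset Φ) z × forbiddenParam z ≤ k + 2 * k * r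

    module R (O : Oracle → Data → Data) (x : DiverseInput) =
      Run forb thr O (countingForbidden (Bounded x)) x (λ _ → 3) (λ _ → 3)
    open R

    three : ∀ {M d d′} → 1 ≤ M → d ≤ M → d′ ≤ M → suc (d + d′) ≤ 3 * M
    three {M} p q r = +-mono-≤ p (+-mono-≤ q (≤-trans r (≤-reflexive (sym (+-identityʳ M)))))

    answers : ∀ O → (∀ ω → Solves (oracleProblem 𝔻 Φ ω) (O ω)) → ∀ x → Answers O x
    answers O solves x s F small param≤ = O forbidden (code (ForbiddenSubset Φ) z) , solves forbidden z , cost
      where
      open DiverseInput x
      z : ForbiddenInput Φ
      z = record { I = I ; s = s ; Forb = F }

      answer-small : ∀ {d} → Correct (ForbiddenSubset Φ) z d → size d ≤ M x
      answer-small (inj₂ (refl , _)) = s≤s z≤n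
      answer-small (inj₁ (J , refl , _)) =
        ≤-trans (+-monoʳ-≤ 2 (size-codeSubset J)) (≤-trans
          (+-monoˡ-≤ (∣U∣ Φ I * 4) (m≤m+n 3 (size (codeInstance I) + S x))) (M-query O x))

      cost : CallCost O x forb (code (ForbiddenSubset Φ) z ∷ [])
               (O forbidden (code (ForbiddenSubset Φ) z)) 3 1
      cost .run _ = _ , _ , ask (var zero) , three (s≤s z≤n) small (answer-small (solves forbidden z)) ,
        ≤-refl , (z , refl , ≤-trans param≤ (k+2s≤ O x)) ∷ []

    judges : ∀ O → (∀ ω → Solves (oracleProblem 𝔻 Φ ω) (O ω)) → ∀ x → Judges O x
    judges O solves x Js small = O threshold (code (ThresholdProblem 𝔻) z) , solves threshold z , cost
      where
      open DiverseInput x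
      z : ThresholdInput
      z = record { U = universe (Φ I) ; r = r ; X = Js ; b = b }

      answer-small : ∀ {P d} → Decides P d → size d ≤ M x
      answer-small (inj₁ (refl , _)) = bool-small O x true
      answer-small (inj₂ (refl , _)) = bool-small O x false

      cost : CallCost O x thr (code (ThresholdProblem 𝔻) z ∷ [])
               (O threshold (code (ThresholdProblem 𝔻) z)) 3 0
      cost .run _ = _ , _ , ask (var zero) , three (s≤s z≤n) small (answer-small (solves threshold z)) ,
        z≤n , []

  fpt : PolyTime (ThresholdProblem 𝔻) → FPT (ForbiddenSubset Φ) forbiddenParam →
        FPT (Diverse 𝔻 Φ) diverseParam
  fpt (pₜ , aₜ , cₜ , thr-runs) (p , f , c , f-computable , forb-runs) =
    let (F , C , computable , bound≤) = tractable-bound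
          (tractable-* (tractable-param f⁺-computable) (tractable-^ tractable-M c))
          (tractable-* (tractable-const aₜ) (tractable-^ tractable-M cₜ))
    in algorithm (liftFunction p) (liftFunction pₜ) , F , C , computable , λ x →
      let (y , t , q , run , correct , _ , t≤) = algorithm-runs x (answers x) (judges x)
      in y , t , (q , run) , correct , ≤-trans t≤ (bound≤ x)
    where
    f⁺ : ℕ → ℕ
    -- Every query has parameter at most k + 2 Σ kᵢ, hence at most κ + 2κ².
    f⁺ κ = sumUpTo f (κ + (κ² κ + κ² κ))

    f⁺-computable : Computable f⁺
    f⁺-computable = computable-∘ (computable-sumUpTo f-computable)
      (computable-+ computable-id (computable-+ computable-κ² computable-κ²))

    qf qt : DiverseInput → ℕ
    qf x = f⁺ (κ x) * M x ^ c
    qt x = aₜ * M x ^ cₜ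

    module R (x : DiverseInput) = Run {⊥} (liftFunction p) (liftFunction pₜ) (λ ()) unmetered x qf qt
    open R

    answers : ∀ x → Answers x
    answers x s F small param≤ =
      let (y , t , run , correct , t≤) = forb-runs (record { I = DiverseInput.I x ; s = s ; Forb = F })
      in y , correct , lift-cost (λ ()) unmetered (M x) (s≤s z≤n) run
           (≤-trans t≤ (*-mono-≤ (≤sumUpTo f (≤⇒≤′
             (≤-trans param≤ (+-mono-≤ (m≤m+n (DiverseInput.k x) (DiverseInput.r x))
               (+-mono-≤ (s≤κ² x) (s≤κ² x))))))
             (^-monoˡ-≤ c small)))

    judges : ∀ x → Judges x
    judges x Js small =
      let open DiverseInput x
          (y , t , run , correct , t≤) = thr-runs (record { U = universe (Φ I) ; r = r ; X = Js ; b = b })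
      in y , correct , lift-cost (λ ()) unmetered (M x) (s≤s z≤n) run
        (≤-trans t≤ (*-monoʳ-≤ aₜ (^-monoˡ-≤ cₜ small)))

theorem3 : (Φ : ImplicitSetSystem) → PolyTimeComputable Φ →
    (𝔻 : DiversityFunction) → ConsistentlyDiverse 𝔻 →
    OracleAlgorithm 𝔻 Φ ×
    (PolyTime (ThresholdProblem 𝔻) →
    FPT (ForbiddenSubset Φ) forbiddenParam →
    FPT (Diverse 𝔻 Φ) diverseParam)
theorem3 Φ (universe-polyTime , _) 𝔻 consistent = oracleAlgorithm , fpt
  where open Reduction Φ universe-polyTime 𝔻 consistent
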